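{- Let $G$ be a connected claw-free graph of order $n$. Then $\gamma_{oir2}(G)\geq n/2$. Moreover, $\gamma_{oir2}(G)=n/2$ if and only if $G$ is isomorphic to a graph in the family $\mathcal{G}=\mathcal{G}_1\cup\mathcal{G}_2\cup\mathcal{G}_3$ described in the context.
   Context: All graphs are finite and simple. For a graph $G$, a function $f:V(G)\to\mathcal{P}(\{1,2\})$ is a 2-rainbow dominating function if every vertex $v$ with $f(v)=\emptyset$ satisfies $\bigcup_{u\in N(v)}f(u)=\{1,2\}$. It is an outer-independent 2-rainbow dominating function (OI2RD function) if, in addition, the set $\{v: f(v)=\emptyset\}$ is independent. The weight of $f$ is $\sum_{v\in V(G)}|f(v)|$, and $\gamma_{oir2}(G)$ is the minimum weight of an OI2RD function of $G$. A graph is claw-free if it has no induced subgraph isomorphic to $K_{1,3}$. For $k\geq 1$, a $k$-unit is the graph with vertices $v_1,\dots,v_k,u_1,\dots,u_{k-1}$ whose edges are $v_iv_{i+1}$ and $u_iv_i$, $u_iv_{i+1}$ for $1\le i\le k-1$ (a path $v_1\cdots v_k$ with a triangle on each path edge; it has $k-1$ triangles; a 1-unit is $K_1$). Call $v_1$ and $v_k$ its first and last path vertices. $\mathcal{G}_1$: take integers $r\ge1$ and $k_1,\dots,k_r\ge1$ with $k_1+\dots+k_r$ even, take disjoint units $U_1,\dots,U_r$ where $U_j$ is a $k_j$-unit with path $v^j_1\cdots v^j_{k_j}$, and add new vertices $w_1,\dots,w_r$, where $w_j$ is adjacent exactly to $v^j_{k_j}$ and $v^{j+1}_1$ (indices of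 units taken modulo $r$, so $w_r$ is adjacent to $v^r_{k_r}$ and $v^1_1$). (This includes the cycles $C_n$ with $n\equiv 0 \pmod 4$, when all $k_j=1$.) $\mathcal{G}_2$: take a $k$-unit with $k\ge2$ even (so the number of triangles $k-1$ is odd) and add one new vertex adjacent exactly to $v_1$ and $v_k$. $\mathcal{G}_3$: take a cycle $x_1x_2\cdots x_{2q}x_1$ of even length $2q\ge4$ and, for each cycle edge $x_ix_{i+1}$ (indices mod $2q$), add a new vertex adjacent exactly to $x_i$ and $x_{i+1}$ (so the number of triangles is even). -}

module Defs where

open import Algebra.Properties.CommutativeMonoid.Sum as Sum using ()
open import Data.Empty using (⊥)
open import Data.Fin using (Fin; zero; suc; toℕ; fromℕ; inject₁)
open import Data.Fin.Properties using (all?; any?; suc-injective; toℕ-fromℕ<; toℕ<n)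
open import Data.Fin.Subset as Subset using (Subset; ∣_∣)
open import Data.Fin.Subset.Properties using (anySubset?; _∈?_)
open import Data.Nat
  using (ℕ; zero; suc; _≤_; _<_; NonZero; NonTrivial; nonTrivial⇒nonZero; nonTrivial⇒≢1; _<?_)
open import Data.Nat.DivMod using (_%_; _mod_; m<n⇒m%n≡m; n%n≡0; m%n<n)
open import Data.Nat.Divisibility using (_∣_)
open import Data.Nat.Induction using (<-wellFounded)
open import Data.Nat.Properties using (+-0-commutativeMonoid; ≮⇒≥; m≤n⇒m<n∨m≡n; 1+n≢n)
open import Data.Product using (Σ; ∃; _×_; _,_; proj₁; proj₂)
open import Data.Sum using (_⊎_; inj₁; inj₂)
open import Data.Unit using (⊤)
open import Data.Vec using (Vec; []; _∷_; lookup; tabulate)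
open import Data.Vec.Properties using (lookup∘tabulate; ≡-dec)
open import Data.Bool.Properties as Bool using ()
open import Function.Bundles using (_↔_; _⇔_; module Inverse)
open import Function.Definitions using (Injective)
open import Induction.WellFounded using (Acc; acc)
open import Relation.Binary.Construct.Closure.ReflexiveTransitive using (Star)
open import Relation.Binary.Construct.Closure.Symmetric using (SymClosure; fwd; bwd; symmetric)
open import Relation.Binary.Definitions using (Symmetric; Decidable)
open import Relation.Binary.PropositionalEquality
  using (_≡_; _≢_; refl; sym; trans; cong; subst)
open import Relation.Nullary using (¬_; Dec; yes; no)
open import Relation.Nullary.Decidable using (map′; _×-dec_; _→-dec_; ¬?)
open import Relation.Unary as U using ()

open Sum +-0-commutativeMonoid public using (sum)
open Sum +-0-commutativeMonoid using (sum-cong-≗)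

record Graph (V : Set) : Set₁ where
  infix 4 _~_
  field
    _~_      : V → V → Set
    ~-sym    : Symmetric _~_
    ~-irrefl : ∀ {x} → ¬ x ~ x

fromEdges : ∀ {V} (E : V → V → Set) → (∀ {x} → ¬ E x x) → Graph V
fromEdges E irr = record
  { _~_      = SymClosure E
  ; ~-sym    = symmetric E
  ; ~-irrefl = λ { (fwd e) → irr e ; (bwd e) → irr e }
  }

infix 4 _≅_
_≅_ : ∀ {V W} → Graph V → Graph W → Set
_≅_ {V} {W} G H =
  Σ (V ↔ W) λ φ → ∀ {x y} → (x G.~ y) ⇔ (Inverse.to φ x H.~ Inverse.to φ y)
  where
  module G = Graph G
  module H = Graph H

HasInduced : ∀ {W V} → Graph W → Graph V → Set
HasInduced {W} {V} H G =
  ∃ λ (φ : W → V) → Injective _≡_ _≡_ φ × (∀ {x y} → (x H.~ y) ⇔ (φ x G.~ φ y))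
  where
  module G = Graph G
  module H = Graph H

K : (m n : ℕ) → Graph (Fin m ⊎ Fin n)
K m n = record
  { _~_      = adj
  ; ~-sym    = λ {x} {y} → adj-sym x y
  ; ~-irrefl = λ {x} → adj-irrefl x
  }
  where
  adj : Fin m ⊎ Fin n → Fin m ⊎ Fin n → Set
  adj (inj₁ _) (inj₁ _) = ⊥
  adj (inj₁ _) (inj₂ _) = ⊤
  adj (inj₂ _) (inj₁ _) = ⊤
  adj (inj₂ _) (inj₂ _) = ⊥

  adj-sym : ∀ x y → adj x y → adj y x
  adj-sym (inj₁ _) (inj₂ _) _ = _
  adj-sym (inj₂ _) (inj₁ _) _ = _

  adj-irrefl : ∀ x → ¬ adj x x
  adj-irrefl (inj₁ _) ()
  adj-irrefl (inj₂ _) ()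

ClawFree : ∀ {V} → Graph V → Set
ClawFree G = ¬ HasInduced (K 1 3) G

-- The null graph does not count as connected.
Connected : ∀ {V} → Graph V → Set
Connected {V} G = V × (∀ x y → Star (Graph._~_ G) x y)

Independent : ∀ {V} → Graph V → (V → Set) → Set
Independent G S = ∀ {x y} → S x → S y → ¬ Graph._~_ G x y

-- The colours 1 and 2 are the elements of Fin 2.
record IsOI2RD {V} (G : Graph V) (f : V → Subset 2) : Set where
  open Graph G
  field
    dominating       : ∀ v → f v ≡ Subset.⊥ → ∀ c → ∃ λ u → v ~ u × c Subset.∈ f u
    outerIndependent : Independent G (λ v → f v ≡ Subset.⊥)

weight : ∀ {n} → (Fin n → Subset 2) → ℕ
weight f = sum (λ v → ∣ f v ∣)

record IsMinOI2RDWeight {n} (G : Graph (Fin n)) (k : ℕ) : Set where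
  field
    attained : ∃ λ f → IsOI2RD G f × weight f ≡ k
    minimal  : ∀ f → IsOI2RD G f → k ≤ weight f

private
  _≟ˢ_ : (p q : Subset 2) → Dec (p ≡ q)
  _≟ˢ_ = ≡-dec Bool._≟_

  isOI2RD? : ∀ {n} (G : Graph (Fin n)) → Decidable (Graph._~_ G) → U.Decidable (IsOI2RD G)
  isOI2RD? G _~?_ f = map′
    (λ (d , i) → record { dominating = d ; outerIndependent = λ {x} {y} p q → i x y p q })
    (λ r → IsOI2RD.dominating r , λ x y p q → IsOI2RD.outerIndependent r p q)
    (all? (λ v → (f v ≟ˢ Subset.⊥) →-dec all? (λ c → any? (λ u → (v ~? u) ×-dec (c ∈? f u))))
      ×-dec
     all? (λ x → all? (λ y → (f x ≟ˢ Subset.⊥) →-dec ((f y ≟ˢ Subset.⊥) →-dec ¬? (x ~? y)))))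

  anyVec? : ∀ {m n} {P : Vec (Subset m) n → Set} → U.Decidable P → Dec (∃ P)
  anyVec? {n = zero}  P? = map′ ([] ,_) (λ { ([] , p) → p }) (P? [])
  anyVec? {n = suc n} P? = map′
    (λ (s , ss , p) → s ∷ ss , p)
    (λ { (s ∷ ss , p) → s , ss , p })
    (anySubset? (λ s → anyVec? (λ ss → P? (s ∷ ss))))

  transport : ∀ {V} (G : Graph V) {f g : V → Subset 2} → (∀ v → f v ≡ g v) →
              IsOI2RD G f → IsOI2RD G g
  transport G f≗g r = record
    { dominating = λ v gv≡⊥ c →
        let u , v~u , c∈fu = IsOI2RD.dominating r v (trans (f≗g v) gv≡⊥) c
        in  u , v~u , subst (c Subset.∈_) (f≗g u) c∈fu
    ; outerIndependent = λ {x} {y} gx≡⊥ gy≡⊥ →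
        IsOI2RD.outerIndependent r (trans (f≗g x) gx≡⊥) (trans (f≗g y) gy≡⊥)
    }

  full-isOI2RD : ∀ {V} (G : Graph V) → IsOI2RD G (λ _ → Subset.⊤)
  full-isOI2RD G = record { dominating = λ _ () ; outerIndependent = λ () }

-- Decidable adjacency is what makes the minimum exist constructively.
minOI2RDWeight-exists : ∀ {n} (G : Graph (Fin n)) → Decidable (Graph._~_ G) →
                        ∃ (IsMinOI2RDWeight G)
minOI2RDWeight-exists {n} G _~?_ = descend _ (full-isOI2RD G) (<-wellFounded _)
  where
  descend : ∀ f → IsOI2RD G f → Acc _<_ (weight f) → ∃ (IsMinOI2RDWeight G)
  descend f r (acc rec)
    with anyVec? {n = n} (λ xs → isOI2RD? G _~?_ (lookup xs) ×-dec (weight (lookup xs) <? weight f))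
  ... | yes (xs , r′ , w′<w) = descend (lookup xs) r′ (rec w′<w)
  ... | no none = weight f , record
    { attained = f , r , refl
    ; minimal  = λ g s → ≮⇒≥ λ wg<wf → none
        ( tabulate g
        , transport G (λ v → sym (lookup∘tabulate g v)) s
        , subst (_< weight f)
            (sum-cong-≗ (λ v → cong ∣_∣ (sym (lookup∘tabulate g v)))) wg<wf )
    }

γoir2 : ∀ {n} (G : Graph (Fin n)) → Decidable (Graph._~_ G) → ℕ
γoir2 G _~?_ = proj₁ (minOI2RDWeight-exists G _~?_)

γoir2-isMin : ∀ {n} (G : Graph (Fin n)) (_~?_ : Decidable (Graph._~_ G)) →
              IsMinOI2RDWeight G (γoir2 G _~?_)
γoir2-isMin G _~?_ = proj₂ (minOI2RDWeight-exists G _~?_)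

-- A k-unit, k ≥ 1, is indexed by its number of triangles t = k - 1.
data UnitVertex (t : ℕ) : Set where
  v⟨_⟩ : Fin (suc t) → UnitVertex t
  u⟨_⟩ : Fin t → UnitVertex t

data UnitEdge {t} : UnitVertex t → UnitVertex t → Set where
  path  : ∀ i → UnitEdge v⟨ inject₁ i ⟩ v⟨ suc i ⟩
  left  : ∀ i → UnitEdge u⟨ i ⟩ v⟨ inject₁ i ⟩
  right : ∀ i → UnitEdge u⟨ i ⟩ v⟨ suc i ⟩

first last : ∀ {t} → UnitVertex t
first    = v⟨ zero ⟩
last {t} = v⟨ fromℕ t ⟩

private
  inject₁≢suc : ∀ {n} (i : Fin n) → inject₁ i ≢ suc i
  inject₁≢suc zero    ()
  inject₁≢suc (suc i) eq = inject₁≢suc i (suc-injective eq)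

  unitEdge-≢ : ∀ {t} {x y : UnitVertex t} → UnitEdge x y → x ≢ y
  unitEdge-≢ (path i) eq = inject₁≢suc i (v-inj eq)
    where
    v-inj : ∀ {t} {i j : Fin (suc t)} → v⟨ i ⟩ ≡ v⟨ j ⟩ → i ≡ j
    v-inj refl = refl
  unitEdge-≢ (left i) ()
  unitEdge-≢ (right i) ()

next : ∀ {n} .{{_ : NonZero n}} → Fin n → Fin n
next {n} i = suc (toℕ i) mod n

private
  next-≢ : ∀ {n} .{{_ : NonZero n}} → n ≢ 1 → (i : Fin n) → next i ≢ i
  next-≢ {n} n≢1 i next≡i = case (m≤n⇒m<n∨m≡n (toℕ<n i))
    where
    toℕ-eq : suc (toℕ i) % n ≡ toℕ i
    toℕ-eq = trans (sym (toℕ-fromℕ< (m%n<n (suc (toℕ i)) n))) (cong toℕ next≡i)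

    case : suc (toℕ i) < n ⊎ suc (toℕ i) ≡ n → ⊥
    case (inj₁ 1+i<n) = 1+n≢n (trans (sym (m<n⇒m%n≡m 1+i<n)) toℕ-eq)
    case (inj₂ 1+i≡n) = n≢1 (trans (sym 1+i≡n) (cong suc i≡0))
      where
      i≡0 : toℕ i ≡ 0
      i≡0 = trans (sym toℕ-eq) (trans (cong (_% n) 1+i≡n) (n%n≡0 n))

data UnitRingVertex {r} (t : Fin r → ℕ) : Set where
  unit : ∀ j → UnitVertex (t j) → UnitRingVertex t
  w⟨_⟩ : Fin r → UnitRingVertex t

data UnitRingEdge {r} .{{_ : NonZero r}} (t : Fin r → ℕ) :
                  UnitRingVertex t → UnitRingVertex t → Set where
  inUnit  : ∀ j {x y} → UnitEdge x y → UnitRingEdge t (unit j x) (unit j y)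
  toLast  : ∀ j → UnitRingEdge t w⟨ j ⟩ (unit j last)
  toFirst : ∀ j → UnitRingEdge t w⟨ j ⟩ (unit (next j) first)

UnitRing : ∀ {r} .{{_ : NonZero r}} (t : Fin r → ℕ) → Graph (UnitRingVertex t)
UnitRing t = fromEdges (UnitRingEdge t) λ { (inUnit j e) → unitEdge-≢ e refl }

data ClosedUnitVertex (t : ℕ) : Set where
  unit : UnitVertex t → ClosedUnitVertex t
  apex : ClosedUnitVertex t

data ClosedUnitEdge {t} : ClosedUnitVertex t → ClosedUnitVertex t → Set where
  inUnit  : ∀ {x y} → UnitEdge x y → ClosedUnitEdge (unit x) (unit y)
  toFirst : ClosedUnitEdge apex (unit first)
  toLast  : ClosedUnitEdge apex (unit last)

ClosedUnit : ∀ t → Graph (ClosedUnitVertex t)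
ClosedUnit t = fromEdges ClosedUnitEdge λ { (inUnit e) → unitEdge-≢ e refl }

data TriangleCycleVertex (l : ℕ) : Set where
  x⟨_⟩ : Fin l → TriangleCycleVertex l
  y⟨_⟩ : Fin l → TriangleCycleVertex l

data TriangleCycleEdge {l} .{{_ : NonZero l}} :
                       TriangleCycleVertex l → TriangleCycleVertex l → Set where
  cycle : ∀ i → TriangleCycleEdge x⟨ i ⟩ x⟨ next i ⟩
  left  : ∀ i → TriangleCycleEdge y⟨ i ⟩ x⟨ i ⟩
  right : ∀ i → TriangleCycleEdge y⟨ i ⟩ x⟨ next i ⟩

TriangleCycle : ∀ l .{{_ : NonTrivial l}} → Graph (TriangleCycleVertex l)
TriangleCycle l = fromEdges TriangleCycleEdge (λ e → edge-≢ e refl)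
  where
  instance _ = nonTrivial⇒nonZero l

  x-inj : ∀ {i j : Fin l} → x⟨ i ⟩ ≡ x⟨ j ⟩ → i ≡ j
  x-inj refl = refl

  edge-≢ : ∀ {p q : TriangleCycleVertex l} → TriangleCycleEdge p q → p ≢ q
  edge-≢ (cycle i) eq = next-≢ (nonTrivial⇒≢1 {l}) i (sym (x-inj eq))
  edge-≢ (left i) ()
  edge-≢ (right i) ()

data 𝒢₁ {V} (G : Graph V) : Set where
  mk : ∀ {r} .{{_ : NonZero r}} (t : Fin r → ℕ) →
       2 ∣ sum (λ j → suc (t j)) → G ≅ UnitRing t → 𝒢₁ G

data 𝒢₂ {V} (G : Graph V) : Set where
  mk : ∀ t → 2 ≤ suc t → 2 ∣ suc t → G ≅ ClosedUnit t → 𝒢₂ G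

data 𝒢₃ {V} (G : Graph V) : Set where
  mk : ∀ l .{{_ : NonTrivial l}} → 4 ≤ l → 2 ∣ l → G ≅ TriangleCycle l → 𝒢₃ G

𝒢 : ∀ {V} → Graph V → Set
𝒢 G = 𝒢₁ G ⊎ 𝒢₂ G ⊎ 𝒢₃ G

{-# OPTIONS --safe #-}
module Submission where

-- Let f be an OI2RD function. By claw-freeness a vertex has at most two neighbours with empty label,
-- while an empty vertex has a neighbour of each colour k. Counting, for each k, the pairs ("spokes")
-- of an empty vertex and a neighbour carrying k gives #empty ≤ 2 #(carrying k); summing over k,
-- #empty ≤ w(f), and n ≤ #empty + w(f) ≤ 2 w(f).
--
-- In the case of equality the spokes form a 2-regular bipartite graph between empty and coloured
-- vertices, with the colours alternating along each cycle. By claw-freeness a further edge at a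
-- coloured vertex can only lead to the next coloured vertex of the same cycle, so by connectivity G is
-- a single cycle x₀ a₀ x₁ a₁ … (aᵢ empty, evenly many xᵢ) with some edges xᵢ xᵢ₊₁ added. The missing
-- edges xᵢ xᵢ₊₁ cut it into units; if none is missing, G is a cycle of triangles, which for two
-- triangles is the closed 2-unit. Conversely, colouring the path vertices alternately has weight n/2.

open import Defs
open import Data.Bool using (true; false)
open import Data.Empty using (⊥; ⊥-elim)
open import Data.Fin using (Fin; zero; suc; toℕ; fromℕ; inject₁; combine)
open import Data.Fin.Patterns using (0F; 1F)
open import Data.Fin.Properties as Fin using ()
open import Data.Fin.Permutation using (Permutation)
open import Data.Fin.Relation.Unary.Top using (View; view; ‵fromℕ; ‵inject₁; view-fromℕ; view-inject₁)
open import Data.Fin.Subset as Subset using (Subset; ∣_∣)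
open import Data.Fin.Subset.Properties using (_∈?_)
open import Data.List using (List; []; _∷_; length; filter; allFin; tabulate)
open import Data.List.Membership.Propositional using (_∈_)
open import Data.List.Membership.Propositional.Properties using (∈-filter⁺; ∈-filter⁻; ∈-allFin)
open import Data.List.Relation.Unary.All using (_∷_)
open import Data.List.Relation.Unary.Any using (here; there)
open import Data.List.Relation.Unary.AllPairs using (_∷_)
open import Data.List.Relation.Unary.Unique.Propositional using (Unique)
open import Data.List.Relation.Unary.Unique.Propositional.Properties using (allFin⁺; filter⁺)
open import Data.Nat
open import Data.Nat.DivMod using (m<n⇒m%n≡m; n%n≡0; m%n<n)
open import Data.Nat.Divisibility using (_∣_; divides; ∣⇒≤; ∣m∣n⇒∣m+n; ∣-refl; _∣0)
open import Data.Nat.Induction using (<-wellFounded)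
open import Data.Nat.Properties
open import Data.Product using (∃; _×_; _,_; proj₁; proj₂)
open import Data.Sum using (_⊎_; inj₁; inj₂)
open import Data.Unit using (tt)
open import Data.Vec using ([]; _∷_)
open import Data.Vec.Base using (here; there)
open import Data.Vec.Properties using (≡-dec)
open import Data.Bool.Properties as Bool using ()
open import Algebra.Properties.CommutativeMonoid.Sum +-0-commutativeMonoid
  using (sum-cong-≗; ∑-distrib-+; ∑-comm; sum-permute)
open import Function using (_∘_)
open import Function.Bundles using (_↔_; _⇔_; mk⇔; mk↔ₛ′; module Inverse; module Equivalence)
open import Function.Construct.Composition using (_⇔-∘_)
open import Function.Definitions using (Injective)
open import Function.Properties.Inverse using (↔-sym; ↔-trans)
open import Induction.WellFounded using (Acc; acc)
open import Relation.Binary.Construct.Closure.ReflexiveTransitive using (Star; ε; _◅_)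
open import Relation.Binary.Construct.Closure.Symmetric using (SymClosure; fwd; bwd; fold; symmetric)
open import Relation.Binary.Definitions using (Decidable; tri<; tri≈; tri>)
open import Relation.Binary.PropositionalEquality
open import Relation.Nullary using (¬_; Dec; yes; no; contradiction)
open import Relation.Nullary.Decidable using (map′; _×-dec_; ¬?; decidable-stable; recompute)
open import Relation.Unary as U using ()

-- Finite sums and counting.

ind : ∀ {P : Set} → Dec P → ℕ
ind (yes _) = 1
ind (no _)  = 0

sum-mono : ∀ {n} {f g : Fin n → ℕ} → (∀ i → f i ≤ g i) → sum f ≤ sum g
sum-mono {zero}  f≤g = z≤n
sum-mono {suc n} f≤g = +-mono-≤ (f≤g zero) (sum-mono (f≤g ∘ suc))

squeeze : ∀ {a b c d} → a ≤ b → c ≤ d → b + d ≤ a + c → a ≡ b × c ≡ d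
squeeze {a} {b} {c} {d} a≤b c≤d bd≤ac =
  ≤-antisym a≤b (+-cancelʳ-≤ c b a (≤-trans (+-monoʳ-≤ b c≤d) bd≤ac)) ,
  ≤-antisym c≤d (+-cancelˡ-≤ a d c (≤-trans (+-monoˡ-≤ d a≤b) bd≤ac))

-- This carries a tight global inequality back to each vertex: termwise bounds whose totals meet
-- have no slack anywhere.
sum-squeeze : ∀ {n} {f g : Fin n → ℕ} → (∀ i → f i ≤ g i) → sum g ≤ sum f → ∀ i → f i ≡ g i
sum-squeeze f≤g Σg≤Σf zero    = proj₁ (squeeze (f≤g zero) (sum-mono (f≤g ∘ suc)) Σg≤Σf)
sum-squeeze f≤g Σg≤Σf (suc i) =
  sum-squeeze (f≤g ∘ suc)
    (≤-reflexive (sym (proj₂ (squeeze (f≤g zero) (sum-mono (f≤g ∘ suc)) Σg≤Σf)))) i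

sum-1 : ∀ n → sum {n} (λ _ → 1) ≡ n
sum-1 zero    = refl
sum-1 (suc n) = cong suc (sum-1 n)

sum-double : ∀ {n} (f : Fin n → ℕ) → sum (λ i → 2 * f i) ≡ 2 * sum f
sum-double f = trans (∑-distrib-+ f (λ i → f i + 0))
  (cong (sum f +_) (trans (sum-cong-≗ (λ i → +-identityʳ (f i))) (sym (+-identityʳ _))))

module _ {n : ℕ} {P : Fin n → Set} (P? : U.Decidable P) where

  count : ℕ
  count = sum (λ i → ind (P? i))

  private
    -- Bounds on the count become case splits on the length of this duplicate-free list.
    satisfying : List (Fin n)
    satisfying = filter P? (allFin n)

    ∈⁺ : ∀ {i} → P i → i ∈ satisfying
    ∈⁺ {i} = ∈-filter⁺ P? (∈-allFin i)

    ∈⁻ : ∀ {i} → i ∈ satisfying → P i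
    ∈⁻ = proj₂ ∘ ∈-filter⁻ P? {xs = allFin n}

    unique : Unique satisfying
    unique = filter⁺ P? (allFin⁺ n)

    -- Stated for an arbitrary enumeration `g`, because the tail of `tabulate g` enumerates
    -- `g ∘ suc`.
    length-filter : ∀ {k} (g : Fin k → Fin n) →
                    length (filter P? (tabulate g)) ≡ sum (λ i → ind (P? (g i)))
    length-filter {zero}  g = refl
    length-filter {suc k} g with P? (g zero)
    ... | yes _ = cong suc (length-filter (g ∘ suc))
    ... | no  _ = length-filter (g ∘ suc)

    length≡count : length satisfying ≡ count
    length≡count = length-filter (λ i → i)

  count≥1 : ∀ {i} → P i → 1 ≤ count
  count≥1 Pi rewrite sym length≡count with satisfying | ∈⁺ Pi
  ... | _ ∷ _ | _ = s≤s z≤n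

  count≤0 : (∀ i → ¬ P i) → count ≤ 0
  count≤0 none rewrite sym length≡count with satisfying | ∈⁻
  ... | []    | _  = z≤n
  ... | _ ∷ _ | from = contradiction (from (here refl)) (none _)

  count≤1⇒unique : count ≤ 1 → ∀ {i j} → P i → P j → i ≡ j
  count≤1⇒unique c≤1 Pi Pj rewrite sym length≡count with satisfying | ∈⁺ Pi | ∈⁺ Pj
  ... | _ ∷ []    | here refl | here refl = refl
  ... | _ ∷ _ ∷ _ | _ | _ = contradiction c≤1 λ { (s≤s ()) }

  count≤2 : (∀ {i j k} → P i → P j → P k → i ≢ j → i ≢ k → j ≢ k → ⊥) → count ≤ 2
  count≤2 no3 rewrite sym length≡count with satisfying | ∈⁻ | unique
  ... | []         | _ | _ = z≤n
  ... | _ ∷ []     | _ | _ = s≤s z≤n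
  ... | _ ∷ _ ∷ [] | _ | _ = s≤s (s≤s z≤n)
  ... | _ ∷ _ ∷ _ ∷ _ | from | (i≢j ∷ i≢k ∷ _) ∷ (j≢k ∷ _) ∷ _ =
    ⊥-elim (no3 (from (here refl)) (from (there (here refl))) (from (there (there (here refl))))
                i≢j i≢k j≢k)

  count≡2⇒∃ : count ≡ 2 → ∃ P
  count≡2⇒∃ c≡2 rewrite sym length≡count with satisfying | ∈⁻
  ... | _ ∷ _ | from = _ , from (here refl)

  count≡2⇒other : count ≡ 2 → ∀ {i} → P i →
                  ∃ λ j → P j × j ≢ i × (∀ {k} → P k → k ≡ i ⊎ k ≡ j)
  count≡2⇒other c≡2 Pi rewrite sym length≡count with satisfying | ∈⁻ | unique | (λ {k} → ∈⁺ {k})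
  -- The membership facts were abstracted together with the list, so `to` now says that `i` and `j`
  -- are the only witnesses; the given one is whichever of them `to Pi` selects.
  ... | i ∷ j ∷ [] | from | (i≢j ∷ _) ∷ _ | to with to Pi
  ...   | here refl = j , from (there (here refl)) , i≢j ∘ sym , λ Pk → case₁ (to Pk)
    where
    case₁ : ∀ {k} → k ∈ (i ∷ j ∷ []) → k ≡ i ⊎ k ≡ j
    case₁ (here p)         = inj₁ p
    case₁ (there (here p)) = inj₂ p
  ...   | there (here refl) = i , from (here refl) , i≢j , λ Pk → case₂ (to Pk)
    where
    case₂ : ∀ {k} → k ∈ (i ∷ j ∷ []) → k ≡ j ⊎ k ≡ i
    case₂ (here p)         = inj₂ p
    case₂ (there (here p)) = inj₁ p

-- Claws, and labels with two colours.

claw⇒⊥ : ∀ {V} {G : Graph V} → let open Graph G in ClawFree G →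
         ∀ {u a b c} → u ~ a → u ~ b → u ~ c → a ≢ b → a ≢ c → b ≢ c →
         ¬ a ~ b → ¬ a ~ c → ¬ b ~ c → ⊥
claw⇒⊥ {V} {G} free {u} {a} {b} {c} ua ub uc a≢b a≢c b≢c ¬ab ¬ac ¬bc =
  free (φ , φ-injective , λ {x} {y} → mk⇔ (preserves x y) (reflects x y))
  where
  open Graph G

  leaf : Fin 3 → V
  leaf zero             = a
  leaf (suc zero)       = b
  leaf (suc (suc zero)) = c

  φ : Fin 1 ⊎ Fin 3 → V
  φ (inj₁ _) = u
  φ (inj₂ i) = leaf i

  u~leaf : ∀ i → u ~ leaf i
  u~leaf zero             = ua
  u~leaf (suc zero)       = ub
  u~leaf (suc (suc zero)) = uc

  leaf-injective : ∀ i j → leaf i ≡ leaf j → i ≡ j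
  leaf-injective zero zero _ = refl
  leaf-injective zero (suc zero) p = contradiction p a≢b
  leaf-injective zero (suc (suc zero)) p = contradiction p a≢c
  leaf-injective (suc zero) zero p = contradiction (sym p) a≢b
  leaf-injective (suc zero) (suc zero) _ = refl
  leaf-injective (suc zero) (suc (suc zero)) p = contradiction p b≢c
  leaf-injective (suc (suc zero)) zero p = contradiction (sym p) a≢c
  leaf-injective (suc (suc zero)) (suc zero) p = contradiction (sym p) b≢c
  leaf-injective (suc (suc zero)) (suc (suc zero)) _ = refl

  leaves-independent : ∀ i j → ¬ leaf i ~ leaf j
  leaves-independent zero zero = ~-irrefl
  leaves-independent zero (suc zero) = ¬ab
  leaves-independent zero (suc (suc zero)) = ¬ac
  leaves-independent (suc zero) zero = ¬ab ∘ ~-sym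
  leaves-independent (suc zero) (suc zero) = ~-irrefl
  leaves-independent (suc zero) (suc (suc zero)) = ¬bc
  leaves-independent (suc (suc zero)) zero = ¬ac ∘ ~-sym
  leaves-independent (suc (suc zero)) (suc zero) = ¬bc ∘ ~-sym
  leaves-independent (suc (suc zero)) (suc (suc zero)) = ~-irrefl

  φ-injective : Injective _≡_ _≡_ φ
  φ-injective {inj₁ zero} {inj₁ zero} _ = refl
  -- The centre differs from each leaf because it is adjacent to it.
  φ-injective {inj₁ zero} {inj₂ j} p = contradiction (subst (u ~_) (sym p) (u~leaf j)) ~-irrefl
  φ-injective {inj₂ i} {inj₁ zero} p = contradiction (subst (u ~_) p (u~leaf i)) ~-irrefl
  φ-injective {inj₂ i} {inj₂ j} p = cong inj₂ (leaf-injective i j p)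

  preserves : ∀ x y → Graph._~_ (K 1 3) x y → φ x ~ φ y
  preserves (inj₁ _) (inj₂ j) _ = u~leaf j
  preserves (inj₂ i) (inj₁ _) _ = ~-sym (u~leaf i)

  reflects : ∀ x y → φ x ~ φ y → Graph._~_ (K 1 3) x y
  reflects (inj₁ _) (inj₁ _) e = contradiction e ~-irrefl
  reflects (inj₁ _) (inj₂ _) _ = tt
  reflects (inj₂ _) (inj₁ _) _ = tt
  reflects (inj₂ i) (inj₂ j) e = contradiction e (leaves-independent i j)

other : Fin 2 → Fin 2
other 0F = 1F
other 1F = 0F

other-≢ : ∀ k → other k ≢ k
other-≢ 0F ()
other-≢ 1F ()

two-colours : ∀ k l → l ≡ k ⊎ l ≡ other k
two-colours 0F 0F = inj₁ refl
two-colours 0F 1F = inj₂ refl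
two-colours 1F 0F = inj₂ refl
two-colours 1F 1F = inj₁ refl

_≟∅ : (s : Subset 2) → Dec (s ≡ Subset.⊥)
s ≟∅ = ≡-dec Bool._≟_ s Subset.⊥

∣∣-colours : (s : Subset 2) → ∣ s ∣ ≡ ind (0F ∈? s) + ind (1F ∈? s)
∣∣-colours (true  ∷ true  ∷ []) = refl
∣∣-colours (true  ∷ false ∷ []) = refl
∣∣-colours (false ∷ true  ∷ []) = refl
∣∣-colours (false ∷ false ∷ []) = refl

empty⊎coloured : (s : Subset 2) → s ≡ Subset.⊥ ⊎ ∃ λ k → k Subset.∈ s
empty⊎coloured (true  ∷ _     ∷ []) = inj₂ (0F , here)
empty⊎coloured (false ∷ true  ∷ []) = inj₂ (1F , there here)
empty⊎coloured (false ∷ false ∷ []) = inj₁ refl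

∈⇒≢∅ : ∀ {k : Fin 2} {s} → k Subset.∈ s → s ≢ Subset.⊥
∈⇒≢∅ (there (there ())) refl

1≤ind+∣∣ : ∀ s → 1 ≤ ind (s ≟∅) + ∣ s ∣
1≤ind+∣∣ (true  ∷ true  ∷ []) = s≤s z≤n
1≤ind+∣∣ (true  ∷ false ∷ []) = s≤s z≤n
1≤ind+∣∣ (false ∷ true  ∷ []) = s≤s z≤n
1≤ind+∣∣ (false ∷ false ∷ []) = s≤s z≤n

-- The hypothesis is the equality case of `1≤ind+∣∣`; it excludes the label with both colours.
monochromatic : ∀ s → 1 ≡ ind (s ≟∅) + ∣ s ∣ → ∀ {k l} → k Subset.∈ s → l Subset.∈ s → k ≡ l
monochromatic (true  ∷ false ∷ []) _ here here = refl
monochromatic (true  ∷ false ∷ []) _ here (there (there ()))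
monochromatic (true  ∷ false ∷ []) _ (there (there ())) _
monochromatic (false ∷ true  ∷ []) _ (there here) (there here) = refl
monochromatic (false ∷ true  ∷ []) _ (there here) (there (there ()))
monochromatic (false ∷ true  ∷ []) _ (there (there ())) _
monochromatic (false ∷ false ∷ []) _ (there (there ())) _

-- Double counting of spokes and the lower bound.

module DoubleCounting {n : ℕ} (G : Graph (Fin n)) (_~?_ : Decidable (Graph._~_ G))
                      (claw-free : ClawFree G) (f : Fin n → Subset 2) (r : IsOI2RD G f) where
  open Graph G
  open IsOI2RD r

  Spoke : Fin n → Fin n → Set
  Spoke x a = f a ≡ Subset.⊥ × a ~ x

  spoke? : Decidable Spoke
  spoke? x a = (f a ≟∅) ×-dec (a ~? x)

  -- A spoke whose coloured end carries both colours is counted once for each of them.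
  Spokeₖ : Fin 2 → Fin n → Fin n → Set
  Spokeₖ k x a = Spoke x a × k Subset.∈ f x

  spokeₖ? : ∀ k → Decidable (Spokeₖ k)
  spokeₖ? k x a = spoke? x a ×-dec (k ∈? f x)

  spokes-at-empty : ∀ k a → ind (f a ≟∅) ≤ count (λ x → spokeₖ? k x a)
  spokes-at-empty k a with f a ≟∅ in eq
  ... | no _ = z≤n
  ... | yes fa≡⊥ with x , a~x , k∈fx ← dominating a fa≡⊥ k =
    -- Matching on `f a ≟∅` has also replaced this decision inside the counted predicate; transport
    -- along `eq` reconciles the two forms.
    subst (λ d → 1 ≤ count (λ x → (d ×-dec (a ~? x)) ×-dec (k ∈? f x))) eq
      (count≥1 (λ x → spokeₖ? k x a) ((fa≡⊥ , a~x) , k∈fx))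

  -- The empty ends of spokes are pairwise non-adjacent by outer independence, so three spokes at
  -- `x` would form a claw.
  spokes-at-coloured : ∀ k x → count (spokeₖ? k x) ≤ 2 * ind (k ∈? f x)
  spokes-at-coloured k x with k ∈? f x in eq
  ... | no k∉ = subst (λ d → count (λ a → spoke? x a ×-dec d) ≤ 0) eq
    (count≤0 (spokeₖ? k x) (λ _ → k∉ ∘ proj₂))
  ... | yes _ = subst (λ d → count (λ a → spoke? x a ×-dec d) ≤ 2) eq
    (count≤2 (spokeₖ? k x) λ ((a∅ , a~x) , _) ((b∅ , b~x) , _) ((c∅ , c~x) , _) a≢b a≢c b≢c →
      claw⇒⊥ {G = G} claw-free (~-sym a~x) (~-sym b~x) (~-sym c~x) a≢b a≢c b≢c
        (outerIndependent a∅ b∅) (outerIndependent a∅ c∅) (outerIndependent b∅ c∅))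

  empties : ℕ
  empties = sum (λ a → ind (f a ≟∅))

  spokes coloured : Fin 2 → ℕ
  spokes k   = sum (λ a → count (λ x → spokeₖ? k x a))
  coloured k = sum (λ x → ind (k ∈? f x))

  spokes-by-coloured : ∀ k → spokes k ≡ sum (λ x → count (spokeₖ? k x))
  spokes-by-coloured k = ∑-comm (λ a x → ind (spokeₖ? k x a))

  empties≤spokes : ∀ k → empties ≤ spokes k
  empties≤spokes k = sum-mono (spokes-at-empty k)

  spokes≤coloured : ∀ k → spokes k ≤ 2 * coloured k
  spokes≤coloured k = ≤-trans (≤-reflexive (spokes-by-coloured k))
    (≤-trans (sum-mono (spokes-at-coloured k)) (≤-reflexive (sum-double (λ x → ind (k ∈? f x)))))

  empties≤coloured : ∀ k → empties ≤ 2 * coloured k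
  empties≤coloured k = ≤-trans (empties≤spokes k) (spokes≤coloured k)

  weight≡coloured : weight f ≡ coloured 0F + coloured 1F
  weight≡coloured = trans (sum-cong-≗ (∣∣-colours ∘ f))
    (∑-distrib-+ (λ x → ind (0F ∈? f x)) (λ x → ind (1F ∈? f x)))

  n≤empties+weight : n ≤ empties + weight f
  n≤empties+weight = ≤-trans (≤-reflexive (sym (sum-1 n)))
    (≤-trans (sum-mono (1≤ind+∣∣ ∘ f))
      (≤-reflexive (∑-distrib-+ (λ v → ind (f v ≟∅)) (λ v → ∣ f v ∣))))

  2empties≤2weight : empties + empties ≤ 2 * weight f
  2empties≤2weight = begin
    empties + empties                 ≤⟨ +-mono-≤ (empties≤coloured 0F) (empties≤coloured 1F) ⟩
    2 * coloured 0F + 2 * coloured 1F ≡⟨ *-distribˡ-+ 2 (coloured 0F) (coloured 1F) ⟨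
    2 * (coloured 0F + coloured 1F)   ≡⟨ cong (2 *_) weight≡coloured ⟨
    2 * weight f                      ∎
    where open ≤-Reasoning

  empties≤weight : empties ≤ weight f
  empties≤weight = *-cancelˡ-≤ 2
    (≤-trans (≤-reflexive (cong (empties +_) (+-identityʳ empties))) 2empties≤2weight)

  n≤2weight : n ≤ 2 * weight f
  n≤2weight = ≤-trans n≤empties+weight
    (≤-trans (+-monoˡ-≤ (weight f) empties≤weight)
      (≤-reflexive (cong (weight f +_) (sym (+-identityʳ (weight f))))))

  -- The equality case: all local bounds are tight.

  module Extremal (2w≡n : 2 * weight f ≡ n) where

    weight≤empties : weight f ≤ empties
    weight≤empties = +-cancelʳ-≤ (weight f) (weight f) empties (begin
      weight f + weight f ≡⟨ cong (weight f +_) (+-identityʳ (weight f)) ⟨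
      2 * weight f        ≡⟨ 2w≡n ⟩
      n                   ≤⟨ n≤empties+weight ⟩
      empties + weight f  ∎)
      where open ≤-Reasoning

    -- Both values `2 * coloured k` are at least `empties`, while their sum `2 * weight f` is at
    -- most `empties + empties`; neither bound has slack.
    coloured≤empties : ∀ k → 2 * coloured k ≤ empties
    coloured≤empties = λ { 0F → ≤-reflexive (sym (proj₁ both)) ; 1F → ≤-reflexive (sym (proj₂ both)) }
      where
      open ≤-Reasoning
      both : empties ≡ 2 * coloured 0F × empties ≡ 2 * coloured 1F
      both = squeeze (empties≤coloured 0F) (empties≤coloured 1F) (begin
        2 * coloured 0F + 2 * coloured 1F ≡⟨ *-distribˡ-+ 2 (coloured 0F) (coloured 1F) ⟨
        2 * (coloured 0F + coloured 1F)   ≡⟨ cong (2 *_) weight≡coloured ⟨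
        2 * weight f                      ≡⟨ cong (weight f +_) (+-identityʳ (weight f)) ⟩
        weight f + weight f               ≤⟨ +-mono-≤ weight≤empties weight≤empties ⟩
        empties + empties                 ∎)

    -- Equality in `n≤empties+weight` forces equality in `1≤ind+∣∣` at every vertex.
    one-colour : ∀ v {k l} → k Subset.∈ f v → l Subset.∈ f v → k ≡ l
    one-colour v = monochromatic (f v)
      (sum-squeeze (1≤ind+∣∣ ∘ f) (begin
        sum (λ v → ind (f v ≟∅) + ∣ f v ∣) ≡⟨ ∑-distrib-+ (λ v → ind (f v ≟∅)) (λ v → ∣ f v ∣) ⟩
        empties + weight f                 ≤⟨ +-monoˡ-≤ (weight f) empties≤weight ⟩
        weight f + weight f                ≡⟨ cong (weight f +_) (+-identityʳ (weight f)) ⟨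
        2 * weight f                       ≡⟨ 2w≡n ⟩
        n                                  ≡⟨ sum-1 n ⟨
        sum {n} (λ _ → 1)                  ∎) v)
      where open ≤-Reasoning

    -- The chain from `empties` through `spokes k` and `2 * coloured k` returns to `empties`, so its
    -- termwise inequalities are equalities.
    spokes-at-empty-≡ : ∀ k a → ind (f a ≟∅) ≡ count (λ x → spokeₖ? k x a)
    spokes-at-empty-≡ k = sum-squeeze (spokes-at-empty k)
      (≤-trans (spokes≤coloured k) (coloured≤empties k))

    spokes-at-coloured-≡ : ∀ k x → count (spokeₖ? k x) ≡ 2 * ind (k ∈? f x)
    spokes-at-coloured-≡ k = sum-squeeze (spokes-at-coloured k)
      (≤-trans (≤-reflexive (sum-double (λ x → ind (k ∈? f x))))
        (≤-trans (coloured≤empties k)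
          (≤-trans (empties≤spokes k) (≤-reflexive (spokes-by-coloured k)))))

    unique-spoke : ∀ {k a x y} → Spokeₖ k x a → Spokeₖ k y a → x ≡ y
    unique-spoke {k} {a} = count≤1⇒unique (λ x → spokeₖ? k x a)
      (≤-trans (≤-reflexive (sym (spokes-at-empty-≡ k a))) (ind≤1 (f a ≟∅)))
      where
      ind≤1 : ∀ {P : Set} (d : Dec P) → ind d ≤ 1
      ind≤1 (yes _) = s≤s z≤n
      ind≤1 (no _)  = z≤n

    two-spokes : ∀ {k x} → k Subset.∈ f x → count (spokeₖ? k x) ≡ 2
    two-spokes {k} {x} k∈fx = trans (spokes-at-coloured-≡ k x) (cong (2 *_) (ind-yes (k ∈? f x)))
      where
      ind-yes : (d : Dec (k Subset.∈ f x)) → ind d ≡ 1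
      ind-yes (yes _) = refl
      ind-yes (no k∉) = contradiction k∈fx k∉

    -- Supplies the spoke from which the cycle is traversed.
    spoke-exists : Fin n → ∃ λ x → ∃ λ a → Spoke x a
    spoke-exists v with empty⊎coloured (f v)
    ... | inj₁ v∅ = let x , v~x , _ = dominating v v∅ 0F in x , v , v∅ , v~x
    ... | inj₂ (k , k∈fv) = let a , s , _ = count≡2⇒∃ (spokeₖ? k v) (two-spokes k∈fv) in v , a , s

    spoke-colour : ∀ {x a} → Spoke x a → ∃ λ k → k Subset.∈ f x
    spoke-colour {x} (a∅ , a~x) with empty⊎coloured (f x)
    ... | inj₁ x∅ = contradiction a~x (outerIndependent a∅ x∅)
    ... | inj₂ c  = c

    record OtherTip (x a : Fin n) : Set where
      field
        tip       : Fin n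
        is-spoke  : Spoke tip a
        distinct  : tip ≢ x
        exhausted : ∀ {y} → Spoke y a → y ≡ x ⊎ y ≡ tip
        recolours : ∀ {k} → k Subset.∈ f x → other k Subset.∈ f tip

    abstract
      -- Domination gives a neighbour of `a` with the colour that `x` lacks. Any further tip carries
      -- one of the two colours, and `unique-spoke` identifies it with the tip already found for
      -- that colour.
      other-tip : ∀ {x a} → Spoke x a → OtherTip x a
      other-tip {x} {a} s@(a∅ , _)
        with k , k∈fx ← spoke-colour s
        with y , a~y , l∈fy ← dominating a a∅ (other k) = record
        { tip       = y
        ; is-spoke  = a∅ , a~y
        ; distinct  = λ y≡x → other-≢ k
            (one-colour x (subst (λ z → other k Subset.∈ f z) y≡x l∈fy) k∈fx)
        ; exhausted = λ s′ → tip-of s′ (spoke-colour s′)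
        ; recolours = λ k′∈fx → subst (λ k → other k Subset.∈ f y) (one-colour x k∈fx k′∈fx) l∈fy
        }
        where
        tip-of : ∀ {z} → Spoke z a → ∃ (λ k′ → k′ Subset.∈ f z) → z ≡ x ⊎ z ≡ y
        tip-of s′ (k′ , k′∈fz) with two-colours k k′
        ... | inj₁ refl = inj₁ (unique-spoke (s′ , k′∈fz) (s , k∈fx))
        ... | inj₂ refl = inj₂ (unique-spoke (s′ , k′∈fz) ((a∅ , a~y) , l∈fy))

      -- All spokes at `x` count for the colour `k` of `x`, and `two-spokes` says that there are
      -- exactly two.
      other-foot : ∀ {x a} → Spoke x a →
                   ∃ λ b → Spoke x b × b ≢ a × (∀ {c} → Spoke x c → c ≡ a ⊎ c ≡ b)
      other-foot {x} s with k , k∈fx ← spoke-colour s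
        with b , (s′ , _) , b≢a , only ← count≡2⇒other (spokeₖ? k x) (two-spokes k∈fx) (s , k∈fx) =
        b , s′ , b≢a , λ s″ → only (s″ , k∈fx)

-- Orbits of a product of two fixed-point-free involutions on a finite set.

module Orbit {S : Set} {N : ℕ} (code : S → Fin N) (code-injective : ∀ {s t} → code s ≡ code t → s ≡ t)
             (α β : S → S) (αα : ∀ s → α (α s) ≡ s) (ββ : ∀ s → β (β s) ≡ s)
             (α-moves : ∀ s → α s ≢ s) (β-moves : ∀ s → β s ≢ s) (start : S) where

  -- In the application `α` exchanges the coloured end of a spoke and `β` the empty end, so one step
  -- advances by one coloured and one empty vertex along the cycle.
  orbit : ℕ → S
  orbit zero    = start
  orbit (suc i) = β (α (orbit i))

  private
    α-injective : ∀ {s t} → α s ≡ α t → s ≡ t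
    α-injective {s} {t} p = trans (sym (αα s)) (trans (cong α p) (αα t))

    β-injective : ∀ {s t} → β s ≡ β t → s ≡ t
    β-injective {s} {t} p = trans (sym (ββ s)) (trans (cong β p) (ββ t))

  orbit-pred : ∀ i {s} → orbit (suc i) ≡ β (α s) → orbit i ≡ s
  orbit-pred _ = α-injective ∘ β-injective

  -- Turns `α`-images of the orbit into `β`-images, so that `not-reflected` excludes coincidences
  -- with either.
  α≡β-suc : ∀ i → α (orbit i) ≡ β (orbit (suc i))
  α≡β-suc i = sym (ββ (α (orbit i)))

  private
    -- The step is injective, so a repetition can be pulled back to the start: the orbit is purely
    -- periodic.
    cancel : ∀ i d → orbit i ≡ orbit (i + d) → orbit d ≡ start
    cancel zero    d p = sym p
    cancel (suc i) d p = cancel i d (orbit-pred i p)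

    -- Shifted by one to exclude the trivial return at time 0.
    Returns : ℕ → Set
    Returns m = orbit (suc m) ≡ start

    returns? : U.Decidable Returns
    returns? m = map′ code-injective (cong code) (code (orbit (suc m)) Fin.≟ code start)

    return : ∃ Returns
    -- The `N + 1` first points of the orbit have codes in `Fin N`.
    return with i , j , i<j , p ← Fin.pigeonhole (n<1+n N) (code ∘ orbit ∘ toℕ)
      with d , i+1+d≡j ← m≤n⇒∃[o]m+o≡n i<j =
      d , cancel (toℕ i) (suc d)
            (trans (code-injective p) (cong orbit (trans (sym i+1+d≡j) (sym (+-suc (toℕ i) d)))))

    least : ∀ m → Returns m → Acc _<_ m → ∃ λ m → Returns m × (∀ {i} → i < m → ¬ Returns i)
    least m p (acc rec) with anyUpTo? returns? m
    ... | yes (i , i<m , q) = least i q (rec i<m)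
    ... | no none           = m , p , λ i<m q → none (_ , i<m , q)

  abstract
    minimal-return : ∃ λ m → Returns m × (∀ {i} → i < m → ¬ Returns i)
    minimal-return = least (proj₁ return) (proj₂ return) (<-wellFounded _)

  -- The period of the orbit is 1 + pre-period.
  pre-period : ℕ
  pre-period = proj₁ minimal-return

  orbit-returns : orbit (suc pre-period) ≡ start
  orbit-returns = proj₁ (proj₂ minimal-return)

  private
    -- By `cancel`, a repetition within one period would give a return earlier than the minimal one.
    no-repeat : ∀ {i j} → i < j → j < suc pre-period → orbit i ≢ orbit j
    no-repeat {i} i<j j<m p with d , refl ← m≤n⇒∃[o]m+o≡n i<j =
      proj₂ (proj₂ minimal-return) (≤-trans (s≤s (m≤n+m d i)) (s≤s⁻¹ j<m))
        (cancel i (suc d) (trans p (cong orbit (sym (+-suc i d)))))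

  orbit-injective : ∀ {i j} → i < suc pre-period → j < suc pre-period → orbit i ≡ orbit j → i ≡ j
  orbit-injective {i} {j} i<m j<m p with <-cmp i j
  ... | tri≈ _ i≡j _ = i≡j
  ... | tri< i<j _ _ = ⊥-elim (no-repeat i<j j<m p)
  ... | tri> _ _ j<i = ⊥-elim (no-repeat j<i i<m (sym p))

  private
    -- β conjugates β ∘ α into its inverse, so a coincidence β (orbit i) ≡ orbit j propagates
    -- inwards to one between equal or consecutive indices, where β or α has a fixed point.
    not-reflected-≤ : ∀ d i → β (orbit i) ≢ orbit (d + i)
    not-reflected-≤ zero          i p = β-moves _ p
    not-reflected-≤ (suc zero)    i p = α-moves _ (sym (β-injective p))
    not-reflected-≤ (suc (suc d)) i p = not-reflected-≤ d (suc i)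
      (trans (ββ _) (trans (cong α (β-injective p)) (trans (αα _) (cong orbit (sym (+-suc d i))))))

  -- Each vertex on the cycle belongs to two spokes, exchanged by `α` or `β`. That the orbit never
  -- contains both with matching orientation is what keeps the cycle from revisiting a vertex.
  not-reflected : ∀ i j → β (orbit i) ≢ orbit j
  not-reflected i j p with ≤-total i j
  ... | inj₁ i≤j with d , refl ← m≤n⇒∃[o]m+o≡n i≤j =
    not-reflected-≤ d i (trans p (cong orbit (+-comm i d)))
  ... | inj₂ j≤i with d , refl ← m≤n⇒∃[o]m+o≡n j≤i =
    not-reflected-≤ d j (trans (cong β (sym p)) (trans (ββ _) (cong orbit (+-comm j d))))

-- Necklaces: the cycle traced by the spokes of an extremal function.

record Necklace {V : Set} (G : Graph V) : Set where
  open Graph G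
  field
    pre-size : ℕ
    -- Periodic sequences over all natural numbers, so that successors need no reduction modulo
    -- `size`; distinctness is demanded only within one period.
    x a      : ℕ → V

  size : ℕ
  size = suc pre-size

  field
    2∣size   : 2 ∣ size
    x-wraps  : ∀ i → x (i + size) ≡ x i
    a-wraps  : ∀ i → a (i + size) ≡ a i
    x-injective : ∀ {i j} → i < size → j < size → x i ≡ x j → i ≡ j
    a-injective : ∀ {i j} → i < size → j < size → a i ≡ a j → i ≡ j
    x≢a      : ∀ i j → x i ≢ a j
    a~x      : ∀ i → a i ~ x i
    a~x-suc  : ∀ i → a i ~ x (suc i)
    a-neighbours : ∀ {i v} → a i ~ v → v ≡ x i ⊎ v ≡ x (suc i)
    -- Stated at a successor so that the preceding `x i` and `a i` can be named. Which links
    -- `x i ~ x (suc i)` are present is left open.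
    x-neighbours : ∀ {i v} → x (suc i) ~ v →
                   v ≡ a i ⊎ v ≡ a (suc i) ⊎ v ≡ x i ⊎ v ≡ x (suc (suc i))

module Cycle {n : ℕ} (G : Graph (Fin n)) (_~?_ : Decidable (Graph._~_ G))
             (claw-free : ClawFree G) (f : Fin n → Subset 2) (r : IsOI2RD G f)
             (2w≡n : 2 * weight f ≡ n) where
  open Graph G
  open IsOI2RD r
  open DoubleCounting G _~?_ claw-free f r
  open Extremal 2w≡n
  open OtherTip

  -- The spoke proof is irrelevant, so a flag is determined by its two ends and `code` is injective;
  -- decidability recovers the proof in `spoke`.
  record Flag : Set where
    constructor flag
    field
      tip foot : Fin n
      .spoke   : Spoke tip foot

  open Flag using (foot) renaming (tip to head)

  spoke : (s : Flag) → Spoke (head s) (foot s)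
  spoke (flag x a s) = recompute (spoke? x a) s

  flag-≡ : ∀ {s t} → head s ≡ head t → foot s ≡ foot t → s ≡ t
  flag-≡ {flag _ _ _} {flag _ _ _} refl refl = refl

  code : Flag → Fin (n * n)
  code s = combine (head s) (foot s)

  code-injective : ∀ {s t} → code s ≡ code t → s ≡ t
  code-injective p = let p₁ , p₂ = Fin.combine-injective _ _ _ _ p in flag-≡ p₁ p₂

  -- Abstract, so that iterates of β ∘ α along an orbit are not unfolded.
  abstract
    α β : Flag → Flag
    α s = let o = other-tip (spoke s) in flag (tip o) (foot s) (is-spoke o)
    β s = let b , s′ , _ = other-foot (spoke s) in flag (head s) b s′

    foot-α : ∀ s → foot (α s) ≡ foot s
    foot-α _ = refl

    head-β : ∀ s → head (β s) ≡ head s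
    head-β _ = refl

    α-moves : ∀ s → α s ≢ s
    α-moves s p = distinct (other-tip (spoke s)) (cong head p)

    β-moves : ∀ s → β s ≢ s
    β-moves s p = let _ , _ , b≢a , _ = other-foot (spoke s) in b≢a (cong foot p)

    same-foot : ∀ s {x} → Spoke x (foot s) → x ≡ head s ⊎ x ≡ head (α s)
    same-foot s = exhausted (other-tip (spoke s))

    same-head : ∀ s {a} → Spoke (head s) a → a ≡ foot s ⊎ a ≡ foot (β s)
    same-head s = let _ , _ , _ , only = other-foot (spoke s) in only

    α-recolours : ∀ s {k} → k Subset.∈ f (head s) → other k Subset.∈ f (head (α s))
    α-recolours s = recolours (other-tip (spoke s))

  sharing-foot : ∀ s {t} → foot t ≡ foot s → t ≡ s ⊎ t ≡ α s
  sharing-foot s {t} p with same-foot s (subst (Spoke (head t)) p (spoke t))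
  ... | inj₁ q = inj₁ (flag-≡ q p)
  ... | inj₂ q = inj₂ (flag-≡ q (trans p (sym (foot-α s))))

  sharing-head : ∀ s {t} → head t ≡ head s → t ≡ s ⊎ t ≡ β s
  sharing-head s {t} p with same-head s (subst (λ x → Spoke x (foot t)) p (spoke t))
  ... | inj₁ q = inj₁ (flag-≡ p q)
  ... | inj₂ q = inj₂ (flag-≡ (trans p (sym (head-β s))) q)

  -- `α (α s)` has the same foot as `s`, so it is `s` or `α s`; the latter would be a fixed point of
  -- `α`.
  αα : ∀ s → α (α s) ≡ s
  αα s with sharing-foot s (trans (foot-α (α s)) (foot-α s))
  ... | inj₁ p = p
  ... | inj₂ p = contradiction p (α-moves (α s))

  ββ : ∀ s → β (β s) ≡ s
  ββ s with sharing-head s (trans (head-β (β s)) (head-β s))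
  ... | inj₁ p = p
  ... | inj₂ p = contradiction p (β-moves (β s))

  module _ (start : Flag) where
    open Orbit code code-injective α β αα ββ α-moves β-moves start public

    private
      x a : ℕ → Fin n
      x = head ∘ orbit
      a = foot ∘ orbit

      wraps : ∀ i → orbit (i + suc pre-period) ≡ orbit i
      wraps zero    = orbit-returns
      wraps (suc i) = cong (β ∘ α) (wraps i)

      -- Only two flags have head `x i`, namely `orbit i` and `β (orbit i)`, and the orbit avoids
      -- the second.
      x-injective : ∀ {i j} → i < suc pre-period → j < suc pre-period → x i ≡ x j → i ≡ j
      x-injective {i} {j} i<m j<m p with sharing-head (orbit i) (sym p)
      ... | inj₁ q = orbit-injective i<m j<m (sym q)
      ... | inj₂ q = contradiction (sym q) (not-reflected i j)

      a-injective : ∀ {i j} → i < suc pre-period → j < suc pre-period → a i ≡ a j → i ≡ j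
      a-injective {i} {j} i<m j<m p with sharing-foot (orbit i) (sym p)
      ... | inj₁ q = orbit-injective i<m j<m (sym q)
      ... | inj₂ q = contradiction (trans (sym (α≡β-suc i)) (sym q)) (not-reflected (suc i) j)

      a-prev : ∀ i → a i ≡ foot (β (orbit (suc i)))
      a-prev i = trans (sym (foot-α (orbit i))) (cong foot (α≡β-suc i))

      x-suc : ∀ i → x (suc i) ≡ head (α (orbit i))
      x-suc i = head-β (α (orbit i))

      spoke-suc : ∀ i → Spoke (x (suc i)) (a i)
      spoke-suc i = subst₂ Spoke (sym (x-suc i)) (foot-α (orbit i)) (spoke (α (orbit i)))

      a-neighbours : ∀ {i v} → Spoke v (a i) → v ≡ x i ⊎ v ≡ x (suc i)
      a-neighbours {i} s with same-foot (orbit i) s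
      ... | inj₁ p = inj₁ p
      ... | inj₂ p = inj₂ (trans p (sym (x-suc i)))

      -- An empty neighbour is one of the two feet. A coloured `v` adjacent to neither foot would
      -- complete a claw with `a i` and `a (suc i)`; otherwise `v` is the second neighbour of one of
      -- these feet.
      x-neighbours : ∀ {i v} → x (suc i) ~ v →
                     v ≡ a i ⊎ v ≡ a (suc i) ⊎ v ≡ x i ⊎ v ≡ x (suc (suc i))
      x-neighbours {i} {v} e with f v ≟∅
      ... | yes v∅ with same-head (orbit (suc i)) (v∅ , ~-sym e)
      ...   | inj₁ p = inj₂ (inj₁ p)
      ...   | inj₂ p = inj₁ (trans p (sym (a-prev i)))
      x-neighbours {i} {v} e | no v≢∅ with a i ~? v | a (suc i) ~? v
      ... | yes aᵢ~v | _ with a-neighbours {i} (proj₁ (spoke (orbit i)) , aᵢ~v)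
      ...   | inj₁ p = inj₂ (inj₂ (inj₁ p))
      ...   | inj₂ p = contradiction (subst (x (suc i) ~_) p e) ~-irrefl
      x-neighbours {i} {v} e | no v≢∅ | no _ | yes aᵢ₊₁~v
        with a-neighbours {suc i} (proj₁ (spoke (orbit (suc i))) , aᵢ₊₁~v)
      ...   | inj₁ p = contradiction (subst (x (suc i) ~_) p e) ~-irrefl
      ...   | inj₂ p = inj₂ (inj₂ (inj₂ p))
      x-neighbours {i} {v} e | no v≢∅ | no aᵢ≁v | no aᵢ₊₁≁v =
        ⊥-elim (claw⇒⊥ {G = G} claw-free
          (~-sym (proj₂ (spoke-suc i))) (~-sym (proj₂ (spoke (orbit (suc i))))) e
          (λ p → β-moves (orbit (suc i)) (flag-≡ (head-β (orbit (suc i))) (trans (sym (a-prev i)) p)))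
          (λ p → v≢∅ (subst (λ u → f u ≡ Subset.⊥) p (proj₁ (spoke (orbit i)))))
          (λ p → v≢∅ (subst (λ u → f u ≡ Subset.⊥) p (proj₁ (spoke (orbit (suc i))))))
          (outerIndependent (proj₁ (spoke (orbit i))) (proj₁ (spoke (orbit (suc i)))))
          aᵢ≁v aᵢ₊₁≁v)

      alternate : ℕ → Fin 2 → Fin 2
      alternate zero    k = k
      alternate (suc i) k = other (alternate i k)

      alternates : ∀ {k} i → k Subset.∈ f (x 0) → alternate i k Subset.∈ f (x i)
      alternates zero    k∈ = k∈
      alternates {k} (suc i) k∈ = subst (λ v → other (alternate i k) Subset.∈ f v) (sym (x-suc i))
        (α-recolours (orbit i) (alternates i k∈))

      alternate-even : ∀ i k → alternate i k ≡ k → 2 ∣ i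
      alternate-even zero          k  p = 2 ∣0
      alternate-even (suc zero)    k  p = contradiction p (other-≢ k)
      alternate-even (suc (suc i)) k p =
        ∣m∣n⇒∣m+n ∣-refl (alternate-even i k (trans (sym (other-other (alternate i k))) p))
        where
        other-other : ∀ k → other (other k) ≡ k
        other-other 0F = refl
        other-other 1F = refl

      -- Each step switches the colour, and after a full period the start has its single colour
      -- again.
      2∣period : 2 ∣ suc pre-period
      2∣period with k , k∈ ← spoke-colour (spoke start) =
        alternate-even (suc pre-period) k
          (one-colour (x 0)
            (subst (λ s → alternate (suc pre-period) k Subset.∈ f (head s)) orbit-returns
              (alternates (suc pre-period) k∈))
            k∈)

    necklace : Necklace G
    necklace = record
      { pre-size     = pre-period
      ; x            = x
      ; a            = a
      ; 2∣size       = 2∣period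
      ; x-wraps      = cong head ∘ wraps
      ; a-wraps      = cong foot ∘ wraps
      ; x-injective  = x-injective
      ; a-injective  = a-injective
      ; x≢a          = λ i j p →
          let k , k∈ = spoke-colour (spoke (orbit i))
          in  ∈⇒≢∅ k∈ (trans (cong f p) (proj₁ (spoke (orbit j))))
      ; a~x          = λ i → proj₂ (spoke (orbit i))
      ; a~x-suc      = λ i → proj₂ (spoke-suc i)
      ; a-neighbours = λ {i} e → a-neighbours {i} (proj₁ (spoke (orbit i)) , e)
      ; x-neighbours = λ {i} → x-neighbours {i}
      }

  -- The first outcome leads to a cycle of triangles, the second to a ring of units; there `segment`
  -- will need a missing link at the last index.
  necklace-cases : Fin n →
    (∃ λ (N : Necklace G) → let open Necklace N in ∀ {i} → i < size → x i ~ x (suc i)) ⊎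
    (∃ λ (N : Necklace G) → let open Necklace N in ¬ x pre-size ~ x size)
  necklace-cases v = cases (anyUpTo? (λ i → ¬? (N.x i ~? N.x (suc i))) N.size)
    where
    s : Flag
    s = let x , a , p = spoke-exists v in flag x a p

    module N = Necklace (necklace s)

    -- The orbit is restarted behind a missing edge, so that this edge closes the new necklace.
    restart : ℕ → Flag
    restart i = orbit s (suc i)

    cases : Dec (∃ λ i → i < N.size × ¬ N.x i ~ N.x (suc i)) → _
    cases (no unbroken) = inj₁
      (necklace s , λ {i} i<m → decidable-stable (N.x i ~? N.x (suc i)) λ b → unbroken (i , i<m , b))
    -- By injectivity of the step, the last flag of the new period is `orbit s i`, so its closing
    -- link is the missing one.
    cases (yes (i , _ , b)) = inj₂ (necklace (restart i) , λ e →
      b (subst₂ (λ t t′ → head t ~ head t′)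
          (orbit-pred (restart i) (pre-period (restart i)) (orbit-returns (restart i)))
          (orbit-returns (restart i)) e))

-- Cyclic successors, and cutting a cycle into consecutive blocks.

data Follows (m : ℕ) : ℕ → ℕ → Set where
  step : ∀ {p} → Follows m p (suc p)
  wrap : ∀ {p} → suc p ≡ m → Follows m p 0

-- Replaces the modular arithmetic of `next` by a case split between an ordinary step and the wrap
-- to 0.
next-follows : ∀ {n} .{{_ : NonZero n}} (i : Fin n) → Follows n (toℕ i) (toℕ (next i))
next-follows {n} i with m≤n⇒m<n∨m≡n (Fin.toℕ<n i)
... | inj₁ 1+i<n = subst (Follows n (toℕ i))
  (sym (trans (Fin.toℕ-fromℕ< (m%n<n (suc (toℕ i)) n)) (m<n⇒m%n≡m 1+i<n))) step
... | inj₂ 1+i≡n = subst (Follows n (toℕ i))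
  (sym (trans (Fin.toℕ-fromℕ< (m%n<n (suc (toℕ i)) n)) (trans (cong (_% n) 1+i≡n) (n%n≡0 n)))) (wrap 1+i≡n)

follows-toℕ : ∀ {n} {p} {i j : Fin n} → Follows n p (toℕ i) → Follows n p (toℕ j) → i ≡ j
follows-toℕ {n} {p} {i} {j} s t = Fin.toℕ-injective (unique s t (Fin.toℕ<n i) (Fin.toℕ<n j))
  where
  unique : ∀ {k l} → Follows n p k → Follows n p l → k < n → l < n → k ≡ l
  unique step     step     _ _   = refl
  unique step     (wrap e) k<n _ = contradiction e (<⇒≢ k<n)
  unique (wrap e) step     _ l<n = contradiction e (<⇒≢ l<n)
  unique (wrap _) (wrap _) _ _   = refl

next-surjective : ∀ {n} .{{_ : NonZero n}} (i : Fin n) → ∃ λ j → next j ≡ i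
next-surjective {suc n} zero = fromℕ n ,
  follows-toℕ (next-follows (fromℕ n)) (wrap (cong suc (Fin.toℕ-fromℕ n)))
next-surjective {suc n} (suc i) = inject₁ i ,
  follows-toℕ (next-follows (inject₁ i))
    (subst (λ k → Follows (suc n) k (suc (toℕ i))) (sym (Fin.toℕ-inject₁ i)) step)

-- The position on the whole cycle of the first path vertex of unit `j`; that unit occupies
-- `suc (t j)` positions.
offset : ∀ {r} → (Fin r → ℕ) → Fin r → ℕ
offset t zero    = 0
offset t (suc j) = suc (t zero) + offset (t ∘ suc) j

total : ∀ {r} → (Fin r → ℕ) → ℕ
total t = sum (λ j → suc (t j))

offset-< : ∀ {r} (t : Fin r → ℕ) j {i} → i ≤ t j → offset t j + i < total t
offset-< t zero    i≤t = s≤s (≤-trans i≤t (m≤m+n (t zero) _))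
offset-< t (suc j) {i} i≤t = subst (_< total t) (sym (+-assoc (suc (t zero)) (offset (t ∘ suc) j) i))
  (+-monoʳ-< (suc (t zero)) (offset-< (t ∘ suc) j i≤t))

-- The blocks of positions are consecutive, hence disjoint.
offset-injective : ∀ {r} (t : Fin r → ℕ) j j′ {i i′} → i ≤ t j → i′ ≤ t j′ →
                   offset t j + i ≡ offset t j′ + i′ → j ≡ j′ × i ≡ i′
offset-injective t zero zero _ _ p = refl , p
offset-injective t zero (suc j′) {i} {i′} i≤t _ p =
  contradiction p (<⇒≢ (s≤s (≤-trans i≤t (≤-trans (m≤m+n (t zero) _) (m≤m+n _ i′)))))
offset-injective t (suc j) zero {i} {i′} _ i′≤t p =
  contradiction (sym p) (<⇒≢ (s≤s (≤-trans i′≤t (≤-trans (m≤m+n (t zero) _) (m≤m+n _ i)))))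
offset-injective t (suc j) (suc j′) {i} {i′} i≤t i′≤t p =
  let j≡j′ , i≡i′ = offset-injective (t ∘ suc) j j′ i≤t i′≤t (+-cancelˡ-≡ (suc (t zero)) _ _
        (trans (sym (+-assoc (suc (t zero)) _ i)) (trans p (+-assoc (suc (t zero)) _ i′))))
  in  cong suc j≡j′ , i≡i′

offset-follows : ∀ {r} .{{_ : NonZero r}} (t : Fin r → ℕ) j →
                 Follows (total t) (offset t j + t j) (offset t (next j))
offset-follows {r} t j = go (next j) (next-follows j)
  where
  step-offset : ∀ {r} (t : Fin r → ℕ) j k → toℕ k ≡ suc (toℕ j) → offset t k ≡ suc (offset t j + t j)
  step-offset t zero (suc zero) _ = cong suc (+-identityʳ (t zero))
  step-offset t (suc j) (suc k) p = cong suc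
    (trans (cong (t zero +_) (step-offset (t ∘ suc) j k (suc-injective p)))
      (trans (+-suc (t zero) _) (cong suc (sym (+-assoc (t zero) (offset (t ∘ suc) j) (t (suc j)))))))

  last-offset : ∀ {r} (t : Fin r → ℕ) j → suc (toℕ j) ≡ r → suc (offset t j + t j) ≡ total t
  last-offset {suc zero} t zero _ = cong suc (sym (+-identityʳ (t zero)))
  last-offset {suc (suc r)} t (suc j) p = cong suc
    (trans (cong suc (+-assoc (t zero) (offset (t ∘ suc) j) (t (suc j))))
      (trans (sym (+-suc (t zero) _)) (cong (t zero +_) (last-offset (t ∘ suc) j (suc-injective p)))))

  go : ∀ k → Follows r (toℕ j) (toℕ k) → Follows (total t) (offset t j + t j) (offset t k)
  go k q with toℕ k in eq
  go k step | _ = subst (Follows (total t) (offset t j + t j)) (sym (step-offset t j k eq)) step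
  go zero (wrap e) | _ = wrap (last-offset t j e)

-- `B` marks the breaks, later the missing links: every block ends at a break and has none before
-- its end.
record Segmentation (B : ℕ → Set) (m : ℕ) : Set where
  field
    {r}      : ℕ
    t        : Fin (suc r) → ℕ
    total≡m  : total t ≡ m
    ends     : ∀ j → B (offset t j + t j)
    interior : ∀ j i → i < t j → ¬ B (offset t j + i)

-- Induction peels off position 0: a break there forms a block of its own, otherwise the position is
-- prepended to the first block of the rest.
segment : ∀ {B : ℕ → Set} → U.Decidable B → ∀ m → B m → Segmentation B (suc m)
segment B? zero Bm = record
  { r = 0 ; t = λ _ → 0 ; total≡m = refl ; ends = λ { zero → Bm } ; interior = λ _ _ () }
segment {B} B? (suc m) Bm with B? 0 | segment (B? ∘ suc) m Bm
... | yes B0 | s = record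
  { t = λ { zero → 0 ; (suc j) → t j }
  ; total≡m = cong suc total≡m
  ; ends = λ { zero → B0 ; (suc j) → ends j }
  ; interior = λ { (suc j) → interior j }
  }
  where open Segmentation s
... | no ¬B0 | s = record
  { t = t′
  ; total≡m = cong suc total≡m
  ; ends = λ { zero → ends zero ; (suc j) → ends (suc j) }
  ; interior = λ { zero zero _ → ¬B0
                 ; zero (suc i) (s≤s i<t) → interior zero i i<t
                 ; (suc j) → interior (suc j) }
  }
  where
  open Segmentation s
  t′ : Fin (suc r) → ℕ
  t′ zero    = suc (t zero)
  t′ (suc j) = t (suc j)

-- Constructing graph isomorphisms.

≅-sym : ∀ {V W} {G : Graph V} {H : Graph W} → G ≅ H → H ≅ G
≅-sym {G = G} {H} (φ , e) = ↔-sym φ , λ {x} {y} → mk⇔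
  (λ h → Equivalence.from e (subst₂ H._~_ (sym (strictlyInverseˡ x)) (sym (strictlyInverseˡ y)) h))
  (λ g → subst₂ H._~_ (strictlyInverseˡ x) (strictlyInverseˡ y) (Equivalence.to e g))
  where
  module H = Graph H
  open Inverse φ

≅-trans : ∀ {U V W} {F : Graph U} {G : Graph V} {H : Graph W} → F ≅ G → G ≅ H → F ≅ H
≅-trans (φ , e) (ψ , e′) = ↔-trans φ ψ , e′ ⇔-∘ e

homs⇒≅ : ∀ {V W} {G : Graph V} {H : Graph W} (φ : V ↔ W) →
         let open Inverse φ; open Graph G; open Graph H using () renaming (_~_ to _~′_) in
         (∀ {x y} → x ~ y → to x ~′ to y) → (∀ {x y} → x ~′ y → from x ~ from y) → G ≅ H
homs⇒≅ {G = G} φ to-hom from-hom = φ , λ {x} {y} → mk⇔ to-hom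
  (λ e → subst₂ (Graph._~_ G) (strictlyInverseʳ x) (strictlyInverseʳ y) (from-hom e))
  where
  open Inverse φ

-- An injective homomorphism that lifts neighbours is onto a component.
covering⇒≅ : ∀ {V W} {G : Graph V} {H : Graph W} →
             let open Graph G; open Graph H using () renaming (_~_ to _~′_) in
             Connected G → W → (ψ : W → V) → Injective _≡_ _≡_ ψ →
             (∀ {p q} → p ~′ q → ψ p ~ ψ q) →
             (∀ {p v} → ψ p ~ v → ∃ λ q → p ~′ q × ψ q ≡ v) →
             G ≅ H
covering⇒≅ {V} {W} {G} {H} (_ , joined) w ψ ψ-injective ψ-hom lift =
  ≅-sym {G = H} {H = G} (mk↔ₛ′ ψ (λ v → proj₁ (surjective v)) (λ v → proj₂ (surjective v))
    (λ w → ψ-injective (proj₂ (surjective (ψ w)))) , mk⇔ ψ-hom reflects)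
  where
  module G = Graph G
  module H = Graph H

  walk : ∀ {p v} → Star G._~_ (ψ p) v → ∃ λ q → ψ q ≡ v
  walk {p} ε = p , refl
  walk (e ◅ es) with _ , _ , refl ← lift e = walk es

  surjective : ∀ v → ∃ λ q → ψ q ≡ v
  surjective v = walk (joined (ψ w) v)

  reflects : ∀ {p q} → ψ p G.~ ψ q → p H.~ q
  reflects {p} e with _ , p~q , eq ← lift e = subst (p H.~_) (ψ-injective eq) p~q

-- From a necklace to a cycle of triangles or a ring of units.

module FromNecklace {V : Set} {G : Graph V} (connected : Connected G) (N : Necklace G) where
  open Graph G
  open Necklace N

  x-follows : ∀ {p q} → Follows size p q → x (suc p) ≡ x q
  x-follows step        = refl
  x-follows (wrap refl) = x-wraps 0

  a-follows : ∀ {p q} → Follows size p q → a (suc p) ≡ a q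
  a-follows step        = refl
  a-follows (wrap refl) = a-wraps 0

  x-suc-follows : ∀ {p q} → Follows size p q → x (suc (suc p)) ≡ x (suc q)
  x-suc-follows step        = refl
  x-suc-follows (wrap refl) = x-wraps 1

  -- Moves `x-neighbours` from successor indices to every position of a period; position 0 is
  -- reached through the wrap.
  neighbours : ∀ {p q v} → Follows size p q → x q ~ v →
               v ≡ a p ⊎ v ≡ a q ⊎ v ≡ x p ⊎ v ≡ x (suc q)
  neighbours {p} {q} {v} p↝q e
    with x-neighbours (subst (_~ v) (sym (x-follows p↝q)) e)
  ... | inj₁ eq               = inj₁ eq
  ... | inj₂ (inj₁ eq)        = inj₂ (inj₁ (trans eq (a-follows p↝q)))
  ... | inj₂ (inj₂ (inj₁ eq)) = inj₂ (inj₂ (inj₁ eq))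
  ... | inj₂ (inj₂ (inj₂ eq)) = inj₂ (inj₂ (inj₂ (trans eq (x-suc-follows p↝q))))

  ≅TriangleCycle : .{{_ : NonTrivial size}} → (∀ {i} → i < size → x i ~ x (suc i)) →
                   G ≅ TriangleCycle size
  ≅TriangleCycle linked = covering⇒≅ {G = G} {H = TriangleCycle size} connected x⟨ zero ⟩ ψ ψ-injective ψ-hom lift
    where
    instance _ = nonTrivial⇒nonZero size

    ψ : TriangleCycleVertex size → V
    ψ x⟨ i ⟩ = x (toℕ i)
    ψ y⟨ i ⟩ = a (toℕ i)

    ψ-injective : Injective _≡_ _≡_ ψ
    ψ-injective {x⟨ i ⟩} {x⟨ j ⟩} p = cong x⟨_⟩ (Fin.toℕ-injective (x-injective (Fin.toℕ<n i) (Fin.toℕ<n j) p))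
    ψ-injective {x⟨ i ⟩} {y⟨ j ⟩} p = contradiction p (x≢a (toℕ i) (toℕ j))
    ψ-injective {y⟨ i ⟩} {x⟨ j ⟩} p = contradiction (sym p) (x≢a (toℕ j) (toℕ i))
    ψ-injective {y⟨ i ⟩} {y⟨ j ⟩} p = cong y⟨_⟩ (Fin.toℕ-injective (a-injective (Fin.toℕ<n i) (Fin.toℕ<n j) p))

    x-next : ∀ (i : Fin size) → x (suc (toℕ i)) ≡ x (toℕ (next i))
    x-next i = x-follows (next-follows i)

    edge : ∀ {p q} → TriangleCycleEdge p q → ψ p ~ ψ q
    edge (cycle i) = subst (x (toℕ i) ~_) (x-next i) (linked (Fin.toℕ<n i))
    edge (left i)  = a~x (toℕ i)
    edge (right i) = subst (a (toℕ i) ~_) (x-next i) (a~x-suc (toℕ i))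

    ψ-hom : ∀ {p q} → SymClosure TriangleCycleEdge p q → ψ p ~ ψ q
    ψ-hom (fwd e) = edge e
    ψ-hom (bwd e) = ~-sym (edge e)

    lift : ∀ {p v} → ψ p ~ v → ∃ λ q → SymClosure TriangleCycleEdge p q × ψ q ≡ v
    lift {y⟨ i ⟩} e with a-neighbours e
    ... | inj₁ p = x⟨ i ⟩ , fwd (left i) , sym p
    ... | inj₂ p = x⟨ next i ⟩ , fwd (right i) , sym (trans p (x-next i))
    lift {x⟨ i ⟩} e with next-surjective i
    ... | j , refl with neighbours (next-follows j) e
    ...   | inj₁ p               = y⟨ j ⟩ , bwd (right j) , sym p
    ...   | inj₂ (inj₁ p)        = y⟨ next j ⟩ , bwd (left (next j)) , sym p
    ...   | inj₂ (inj₂ (inj₁ p)) = x⟨ j ⟩ , bwd (cycle j) , sym p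
    ...   | inj₂ (inj₂ (inj₂ p)) = x⟨ next (next j) ⟩ , fwd (cycle (next j)) , sym (trans p (x-next (next j)))

  module _ {r : ℕ} .{{_ : NonZero r}} (t : Fin r → ℕ) (total≡size : total t ≡ size)
           (ends : ∀ j → ¬ x (offset t j + t j) ~ x (suc (offset t j + t j)))
           (interior : ∀ j i → i < t j → x (offset t j + i) ~ x (suc (offset t j + i))) where

    private
      pos : ∀ j → Fin (suc (t j)) → ℕ
      pos j i = offset t j + toℕ i

      bound : ∀ j {i} → i ≤ t j → offset t j + i < size
      bound j i≤t = subst (offset t j + _ <_) total≡size (offset-< t j i≤t)

      toℕ≤ : ∀ {n} (i : Fin (suc n)) → toℕ i ≤ n
      toℕ≤ i = s≤s⁻¹ (Fin.toℕ<n i)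

      -- The empty vertex after the last position of a block sits at a missing link and becomes
      -- `w⟨ j ⟩`; the other empty vertices of the block are apexes of triangles.
      ψ : UnitRingVertex t → V
      ψ (unit j v⟨ i ⟩) = x (pos j i)
      ψ (unit j u⟨ i ⟩) = a (offset t j + toℕ i)
      ψ w⟨ j ⟩          = a (offset t j + t j)

      x-slot : ∀ {j j′ i i′} → i ≤ t j → i′ ≤ t j′ → x (offset t j + i) ≡ x (offset t j′ + i′) →
               j ≡ j′ × i ≡ i′
      x-slot i≤t i′≤t p = offset-injective t _ _ i≤t i′≤t (x-injective (bound _ i≤t) (bound _ i′≤t) p)

      a-slot : ∀ {j j′ i i′} → i ≤ t j → i′ ≤ t j′ → a (offset t j + i) ≡ a (offset t j′ + i′) →
               j ≡ j′ × i ≡ i′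
      a-slot i≤t i′≤t p = offset-injective t _ _ i≤t i′≤t (a-injective (bound _ i≤t) (bound _ i′≤t) p)

      ψ-injective : Injective _≡_ _≡_ ψ
      ψ-injective {unit j v⟨ i ⟩} {unit j′ v⟨ i′ ⟩} p
        with refl , q ← x-slot {j} {j′} (toℕ≤ i) (toℕ≤ i′) p = cong (λ k → unit j v⟨ k ⟩) (Fin.toℕ-injective q)
      ψ-injective {unit j v⟨ i ⟩} {unit j′ u⟨ i′ ⟩} p = contradiction p (x≢a _ _)
      ψ-injective {unit j v⟨ i ⟩} {w⟨ j′ ⟩} p = contradiction p (x≢a _ _)
      ψ-injective {unit j u⟨ i ⟩} {unit j′ v⟨ i′ ⟩} p = contradiction (sym p) (x≢a _ _)
      ψ-injective {unit j u⟨ i ⟩} {unit j′ u⟨ i′ ⟩} p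
        with refl , q ← a-slot {j} {j′} (<⇒≤ (Fin.toℕ<n i)) (<⇒≤ (Fin.toℕ<n i′)) p =
        cong (λ k → unit j u⟨ k ⟩) (Fin.toℕ-injective q)
      ψ-injective {unit j u⟨ i ⟩} {w⟨ j′ ⟩} p
        with refl , q ← a-slot {j} {j′} (<⇒≤ (Fin.toℕ<n i)) ≤-refl p = contradiction q (<⇒≢ (Fin.toℕ<n i))
      ψ-injective {w⟨ j ⟩} {unit j′ v⟨ i′ ⟩} p = contradiction (sym p) (x≢a _ _)
      ψ-injective {w⟨ j ⟩} {unit j′ u⟨ i′ ⟩} p
        with refl , q ← a-slot {j} {j′} ≤-refl (<⇒≤ (Fin.toℕ<n i′)) p = contradiction (sym q) (<⇒≢ (Fin.toℕ<n i′))
      ψ-injective {w⟨ j ⟩} {w⟨ j′ ⟩} p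
        with refl , _ ← a-slot {j} {j′} ≤-refl ≤-refl p = refl

      pos-inject₁ : ∀ j i → pos j (inject₁ i) ≡ offset t j + toℕ i
      pos-inject₁ j i = cong (offset t j +_) (Fin.toℕ-inject₁ i)

      pos-last : ∀ j → pos j (fromℕ (t j)) ≡ offset t j + t j
      pos-last j = cong (offset t j +_) (Fin.toℕ-fromℕ (t j))

      pos-suc : ∀ j (i : Fin (t j)) → pos j (suc i) ≡ suc (offset t j + toℕ i)
      pos-suc j i = +-suc (offset t j) (toℕ i)

      follows-ring : ∀ j → Follows size (offset t j + t j) (pos (next j) zero)
      follows-ring j = subst₂ (λ m q → Follows m (offset t j + t j) q) total≡size
        (sym (+-identityʳ (offset t (next j)))) (offset-follows t j)

      follows-unit : ∀ j (i : Fin (t j)) → Follows size (offset t j + toℕ i) (pos j (suc i))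
      follows-unit j i = subst (Follows size (offset t j + toℕ i)) (sym (pos-suc j i)) step

      edge : ∀ {p q} → UnitRingEdge t p q → ψ p ~ ψ q
      edge (inUnit j (path i))  = subst₂ _~_ (cong x (sym (pos-inject₁ j i))) (cong x (sym (pos-suc j i)))
                                    (interior j (toℕ i) (Fin.toℕ<n i))
      edge (inUnit j (left i))  = subst (_ ~_) (cong x (sym (pos-inject₁ j i))) (a~x (offset t j + toℕ i))
      edge (inUnit j (right i)) = subst (_ ~_) (cong x (sym (pos-suc j i))) (a~x-suc (offset t j + toℕ i))
      edge (toLast j)           = subst (_ ~_) (cong x (sym (pos-last j))) (a~x (offset t j + t j))
      edge (toFirst j)          = subst (_ ~_) (x-follows (follows-ring j)) (a~x-suc (offset t j + t j))

      ψ-hom : ∀ {p q} → SymClosure (UnitRingEdge t) p q → ψ p ~ ψ q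
      ψ-hom (fwd e) = edge e
      ψ-hom (bwd e) = ~-sym (edge e)

      Lift : UnitRingVertex t → V → Set
      Lift p v = ∃ λ q → SymClosure (UnitRingEdge t) p q × ψ q ≡ v

      -- Treats uniformly a predecessor inside the same unit and one across a connecting vertex.
      -- `lift-x` takes the link as an argument, since in the second case `ends` refutes it.
      record Before (j : Fin r) (i : Fin (suc (t j))) : Set where
        field
          p       : ℕ
          follows : Follows size p (pos j i)
          lift-a  : Lift (unit j v⟨ i ⟩) (a p)
          lift-x  : x p ~ x (suc p) → Lift (unit j v⟨ i ⟩) (x p)

      before : ∀ j i → Before j i
      before j zero with j′ , refl ← next-surjective j = record
        { p       = offset t j′ + t j′
        ; follows = follows-ring j′
        ; lift-a  = w⟨ j′ ⟩ , bwd (toFirst j′) , refl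
        ; lift-x  = λ e → contradiction e (ends j′)
        }
      before j (suc i) = record
        { p       = offset t j + toℕ i
        ; follows = follows-unit j i
        ; lift-a  = unit j u⟨ i ⟩ , bwd (inUnit j (right i)) , refl
        ; lift-x  = λ _ → unit j v⟨ inject₁ i ⟩ , bwd (inUnit j (path i)) , cong x (pos-inject₁ j i)
        }

      after-a : ∀ j i → Lift (unit j v⟨ i ⟩) (a (pos j i))
      after-a j i with view i
      ... | ‵fromℕ     = w⟨ j ⟩ , bwd (toLast j) , cong a (sym (pos-last j))
      ... | ‵inject₁ i = unit j u⟨ i ⟩ , bwd (inUnit j (left i)) , cong a (sym (pos-inject₁ j i))

      after-x : ∀ j i → x (pos j i) ~ x (suc (pos j i)) → Lift (unit j v⟨ i ⟩) (x (suc (pos j i)))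
      after-x j i e with view i
      ... | ‵fromℕ     = contradiction (subst (λ p → x p ~ x (suc p)) (pos-last j) e) (ends j)
      ... | ‵inject₁ i = unit j v⟨ suc i ⟩ , fwd (inUnit j (path i)) ,
                         cong x (trans (pos-suc j i) (cong suc (sym (pos-inject₁ j i))))

      lift : ∀ {p v} → ψ p ~ v → Lift p v
      lift {unit j v⟨ i ⟩} e with neighbours (Before.follows (before j i)) e
      ... | inj₁ refl               = Before.lift-a (before j i)
      ... | inj₂ (inj₁ refl)        = after-a j i
      ... | inj₂ (inj₂ (inj₁ refl)) = Before.lift-x (before j i)
        (~-sym (subst (_~ x (Before.p (before j i))) (sym (x-follows (Before.follows (before j i)))) e))
      ... | inj₂ (inj₂ (inj₂ refl)) = after-x j i e
      lift {unit j u⟨ i ⟩} e with a-neighbours e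
      ... | inj₁ p = unit j v⟨ inject₁ i ⟩ , fwd (inUnit j (left i)) , trans (cong x (pos-inject₁ j i)) (sym p)
      ... | inj₂ p = unit j v⟨ suc i ⟩ , fwd (inUnit j (right i)) , trans (cong x (pos-suc j i)) (sym p)
      lift {w⟨ j ⟩} e with a-neighbours e
      ... | inj₁ p = unit j last , fwd (toLast j) , trans (cong x (pos-last j)) (sym p)
      ... | inj₂ p = unit (next j) first , fwd (toFirst j) , trans (sym (x-follows (follows-ring j))) (sym p)

    ≅UnitRing : Fin r → G ≅ UnitRing t
    ≅UnitRing j = covering⇒≅ {G = G} {H = UnitRing t} connected w⟨ j ⟩ ψ ψ-injective ψ-hom lift

-- Functions of weight n/2 on the families.

colour : ℕ → Subset 2
colour zero          = true ∷ false ∷ []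
colour (suc zero)    = false ∷ true ∷ []
colour (suc (suc i)) = colour i

colour-covers : ∀ i c → c Subset.∈ colour i ⊎ c Subset.∈ colour (suc i)
colour-covers zero          0F = inj₁ here
colour-covers zero          1F = inj₂ (there here)
colour-covers (suc zero)    0F = inj₂ here
colour-covers (suc zero)    1F = inj₁ (there here)
colour-covers (suc (suc i)) c  = colour-covers i c

∣colour∣≡1 : ∀ i → ∣ colour i ∣ ≡ 1
∣colour∣≡1 zero          = refl
∣colour∣≡1 (suc zero)    = refl
∣colour∣≡1 (suc (suc i)) = ∣colour∣≡1 i

colour≢∅ : ∀ i → colour i ≢ Subset.⊥
colour≢∅ i p with () ← trans (sym (∣colour∣≡1 i)) (cong ∣_∣ p)

-- Evenness of `m` makes the alternation consistent across the wrap.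
colour-follows : ∀ {m p q} → 2 ∣ m → Follows m p q → colour (suc p) ≡ colour q
colour-follows _               step     = refl
colour-follows (divides k eq) (wrap e) = trans (cong colour (trans e eq)) (colour-even k)
  where
  colour-even : ∀ k → colour (k * 2) ≡ colour 0
  colour-even zero    = refl
  colour-even (suc k) = colour-even k

HalfWeight : ∀ {n} → Graph (Fin n) → Set
HalfWeight {n} G = ∃ λ f → IsOI2RD G f × 2 * weight f ≡ n

-- The involution σ exchanges the empty vertices with those of weight one.
half-weight : ∀ {n W} {G : Graph (Fin n)} {H : Graph W} → G ≅ H →
              (g : W → Subset 2) → IsOI2RD H g →
              (σ : W → W) → (∀ w → σ (σ w) ≡ w) → (∀ w → ∣ g w ∣ + ∣ g (σ w) ∣ ≡ 1) →
              HalfWeight G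
half-weight {n} {W} {G} {H} (φ , e) g r σ σσ balanced = g ∘ to , isOI2RD , 2w≡n
  where
  open Inverse φ
  module H = Graph H

  isOI2RD : IsOI2RD G (g ∘ to)
  isOI2RD = record
    { dominating = λ v v∅ c →
        let w , v~w , c∈ = IsOI2RD.dominating r (to v) v∅ c
        in  from w , Equivalence.from e (subst (to v H.~_) (sym (strictlyInverseˡ w)) v~w) ,
            subst (λ w → c Subset.∈ g w) (sym (strictlyInverseˡ w)) c∈
    ; outerIndependent = λ x∅ y∅ x~y → IsOI2RD.outerIndependent r x∅ y∅ (Equivalence.to e x~y)
    }

  -- `σ` is conjugated by the isomorphism to a permutation of `Fin n`, under which the weight sum is
  -- invariant.
  π : Permutation n n
  π = ↔-trans φ (↔-trans (mk↔ₛ′ σ σ σσ σσ) (↔-sym φ))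

  2w≡n : 2 * weight (g ∘ to) ≡ n
  2w≡n = begin
    2 * weight (g ∘ to)
      ≡⟨ cong (weight (g ∘ to) +_) (+-identityʳ _) ⟩
    weight (g ∘ to) + weight (g ∘ to)
      ≡⟨ cong (weight (g ∘ to) +_) (sum-permute (λ v → ∣ g (to v) ∣) π) ⟩
    weight (g ∘ to) + sum (λ v → ∣ g (to (from (σ (to v)))) ∣)
      ≡⟨ cong (weight (g ∘ to) +_) (sum-cong-≗ (λ v → cong (∣_∣ ∘ g) (strictlyInverseˡ (σ (to v))))) ⟩
    weight (g ∘ to) + sum (λ v → ∣ g (σ (to v)) ∣)
      ≡⟨ ∑-distrib-+ (λ v → ∣ g (to v) ∣) (λ v → ∣ g (σ (to v)) ∣) ⟨
    sum (λ v → ∣ g (to v) ∣ + ∣ g (σ (to v)) ∣)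
      ≡⟨ sum-cong-≗ (balanced ∘ to) ⟩
    sum {n} (λ _ → 1)
      ≡⟨ sum-1 n ⟩
    n ∎
    where open ≡-Reasoning

module _ {r : ℕ} .{{_ : NonZero r}} (t : Fin r → ℕ) (even : 2 ∣ total t) where

  private
    g : UnitRingVertex t → Subset 2
    g (unit j v⟨ i ⟩) = colour (offset t j + toℕ i)
    g (unit j u⟨ i ⟩) = Subset.⊥
    g w⟨ j ⟩          = Subset.⊥

    -- Every generating edge is directed towards a path vertex, so no edge joins two empty vertices.
    target-coloured : ∀ {p q} → UnitRingEdge t p q → g q ≢ Subset.⊥
    target-coloured (inUnit j (path i))  = colour≢∅ (offset t j + suc (toℕ i))
    target-coloured (inUnit j (left i))  = colour≢∅ (offset t j + toℕ (inject₁ i))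
    target-coloured (inUnit j (right i)) = colour≢∅ (offset t j + suc (toℕ i))
    target-coloured (toLast j)           = colour≢∅ (offset t j + toℕ (fromℕ (t j)))
    target-coloured (toFirst j)          = colour≢∅ (offset t (next j) + 0)

    -- The two neighbours of an empty vertex occupy cyclically consecutive positions, hence carry
    -- both colours.
    dominated : ∀ p → g p ≡ Subset.⊥ → ∀ c → ∃ λ q → SymClosure (UnitRingEdge t) p q × c Subset.∈ g q
    dominated (unit j v⟨ i ⟩) p∅ c = contradiction p∅ (colour≢∅ (offset t j + toℕ i))
    dominated (unit j u⟨ i ⟩) _  c with colour-covers (offset t j + toℕ i) c
    ... | inj₁ c∈ = _ , fwd (inUnit j (left i)) ,
                    subst (λ k → c Subset.∈ colour (offset t j + k)) (sym (Fin.toℕ-inject₁ i)) c∈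
    ... | inj₂ c∈ = _ , fwd (inUnit j (right i)) ,
                    subst (λ k → c Subset.∈ colour k) (sym (+-suc (offset t j) (toℕ i))) c∈
    dominated w⟨ j ⟩ _ c with colour-covers (offset t j + t j) c
    ... | inj₁ c∈ = _ , fwd (toLast j) ,
                    subst (λ k → c Subset.∈ colour (offset t j + k)) (sym (Fin.toℕ-fromℕ (t j))) c∈
    ... | inj₂ c∈ = _ , fwd (toFirst j) ,
                    subst (c Subset.∈_)
                      (trans (colour-follows even (offset-follows t j))
                        (cong colour (sym (+-identityʳ (offset t (next j)))))) c∈

    g-isOI2RD : IsOI2RD (UnitRing t) g
    g-isOI2RD = record
      { dominating       = dominated
      ; outerIndependent = λ { p∅ q∅ (fwd e) → target-coloured e q∅ ; p∅ q∅ (bwd e) → target-coloured e p∅ }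
      }

    -- Pairs each path vertex with the empty vertex following it. The view is an argument so that
    -- `σσ` can substitute the known views of `inject₁ i` and `fromℕ (t j)`.
    σᵥ : ∀ j {i : Fin (suc (t j))} → View i → UnitRingVertex t
    σᵥ j ‵fromℕ       = w⟨ j ⟩
    σᵥ j (‵inject₁ i) = unit j u⟨ i ⟩

    σ : UnitRingVertex t → UnitRingVertex t
    σ (unit j v⟨ i ⟩) = σᵥ j (view i)
    σ (unit j u⟨ i ⟩) = unit j v⟨ inject₁ i ⟩
    σ w⟨ j ⟩          = unit j last

    σσ : ∀ p → σ (σ p) ≡ p
    σσ (unit j v⟨ i ⟩) with view i
    ... | ‵fromℕ     = refl
    ... | ‵inject₁ i = refl
    σσ (unit j u⟨ i ⟩) = cong (σᵥ j) (view-inject₁ i)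
    σσ w⟨ j ⟩          = cong (σᵥ j) (view-fromℕ (t j))

    balanced : ∀ p → ∣ g p ∣ + ∣ g (σ p) ∣ ≡ 1
    balanced (unit j v⟨ i ⟩) with view i
    ... | ‵fromℕ     = cong (_+ 0) (∣colour∣≡1 (offset t j + toℕ i))
    ... | ‵inject₁ _ = cong (_+ 0) (∣colour∣≡1 (offset t j + toℕ i))
    balanced (unit j u⟨ i ⟩) = ∣colour∣≡1 (offset t j + toℕ (inject₁ i))
    balanced w⟨ j ⟩          = ∣colour∣≡1 (offset t j + toℕ (fromℕ (t j)))

  unitRing-half : ∀ {n} {G : Graph (Fin n)} → G ≅ UnitRing t → HalfWeight G
  unitRing-half {G = G} iso = half-weight {G = G} {H = UnitRing t} iso g g-isOI2RD σ σσ balanced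

module _ (l : ℕ) .{{_ : NonTrivial l}} (even : 2 ∣ l) where

  private
    instance
      l≢0 : NonZero l
      l≢0 = nonTrivial⇒nonZero l

    g : TriangleCycleVertex l → Subset 2
    g x⟨ i ⟩ = colour (toℕ i)
    g y⟨ i ⟩ = Subset.⊥

    target-coloured : ∀ {p q : TriangleCycleVertex l} → TriangleCycleEdge p q → g q ≢ Subset.⊥
    target-coloured (cycle i) = colour≢∅ (toℕ (next i))
    target-coloured (left i)  = colour≢∅ (toℕ i)
    target-coloured (right i) = colour≢∅ (toℕ (next i))

    dominated : ∀ p → g p ≡ Subset.⊥ → ∀ c → ∃ λ q → SymClosure TriangleCycleEdge p q × c Subset.∈ g q
    dominated x⟨ i ⟩ p∅ c = contradiction p∅ (colour≢∅ (toℕ i))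
    dominated y⟨ i ⟩ _  c with colour-covers (toℕ i) c
    ... | inj₁ c∈ = _ , fwd (left i) , c∈
    ... | inj₂ c∈ = _ , fwd (right i) , subst (c Subset.∈_) (colour-follows even (next-follows i)) c∈

    g-isOI2RD : IsOI2RD (TriangleCycle l) g
    g-isOI2RD = record
      { dominating       = dominated
      ; outerIndependent = λ { p∅ q∅ (fwd e) → target-coloured e q∅ ; p∅ q∅ (bwd e) → target-coloured e p∅ }
      }

    σ : TriangleCycleVertex l → TriangleCycleVertex l
    σ x⟨ i ⟩ = y⟨ i ⟩
    σ y⟨ i ⟩ = x⟨ i ⟩

    σσ : ∀ p → σ (σ p) ≡ p
    σσ x⟨ i ⟩ = refl
    σσ y⟨ i ⟩ = refl

    balanced : ∀ p → ∣ g p ∣ + ∣ g (σ p) ∣ ≡ 1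
    balanced x⟨ i ⟩ = cong (_+ 0) (∣colour∣≡1 (toℕ i))
    balanced y⟨ i ⟩ = ∣colour∣≡1 (toℕ i)

  triangleCycle-half : ∀ {n} {G : Graph (Fin n)} → G ≅ TriangleCycle l → HalfWeight G
  triangleCycle-half {G = G} iso = half-weight {G = G} {H = TriangleCycle l} iso g g-isOI2RD σ σσ balanced

-- Coincidences between the families.

closedUnit≅unitRing : ∀ t → ClosedUnit t ≅ UnitRing {1} (λ _ → t)
closedUnit≅unitRing t = homs⇒≅ {G = ClosedUnit t} {H = UnitRing T} (mk↔ₛ′ to from to-from from-to)
  (fold (symmetric (UnitRingEdge T)) to-edge) (fold (symmetric ClosedUnitEdge) from-edge)
  where
  T : Fin 1 → ℕ
  T _ = t

  to : ClosedUnitVertex t → UnitRingVertex T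
  to (unit x) = unit zero x
  to apex     = w⟨ zero ⟩

  from : UnitRingVertex T → ClosedUnitVertex t
  from (unit zero x) = unit x
  from w⟨ zero ⟩     = apex

  to-from : ∀ p → to (from p) ≡ p
  to-from (unit zero x) = refl
  to-from w⟨ zero ⟩     = refl

  from-to : ∀ p → from (to p) ≡ p
  from-to (unit x) = refl
  from-to apex     = refl

  to-edge : ∀ {p q} → ClosedUnitEdge p q → SymClosure (UnitRingEdge T) (to p) (to q)
  to-edge (inUnit e) = fwd (inUnit zero e)
  -- With a single unit, `next zero` is `zero`, so the connecting vertex meets both ends of the same
  -- unit.
  to-edge toFirst    = fwd (toFirst zero)
  to-edge toLast     = fwd (toLast zero)

  from-edge : ∀ {p q} → UnitRingEdge T p q → SymClosure ClosedUnitEdge (from p) (from q)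
  from-edge (inUnit zero e) = fwd (inUnit e)
  from-edge (toFirst zero)  = fwd toFirst
  from-edge (toLast zero)   = fwd toLast

-- For length 2 the two cycle edges coincide, so the two triangles share an edge; the tip of the
-- second serves as `apex`.
triangleCycle₂≅closedUnit : TriangleCycle 2 ≅ ClosedUnit 1
triangleCycle₂≅closedUnit = homs⇒≅ {G = TriangleCycle 2} {H = ClosedUnit 1}
  (mk↔ₛ′ to from to-from from-to)
  (fold (symmetric ClosedUnitEdge) to-edge) (fold (symmetric TriangleCycleEdge) from-edge)
  where
  to : TriangleCycleVertex 2 → ClosedUnitVertex 1
  to x⟨ i ⟩  = unit v⟨ i ⟩
  to y⟨ 0F ⟩ = unit u⟨ 0F ⟩
  to y⟨ 1F ⟩ = apex

  from : ClosedUnitVertex 1 → TriangleCycleVertex 2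
  from (unit v⟨ i ⟩)  = x⟨ i ⟩
  from (unit u⟨ 0F ⟩) = y⟨ 0F ⟩
  from apex           = y⟨ 1F ⟩

  to-from : ∀ p → to (from p) ≡ p
  to-from (unit v⟨ i ⟩)  = refl
  to-from (unit u⟨ 0F ⟩) = refl
  to-from apex           = refl

  from-to : ∀ p → from (to p) ≡ p
  from-to x⟨ i ⟩  = refl
  from-to y⟨ 0F ⟩ = refl
  from-to y⟨ 1F ⟩ = refl

  to-edge : ∀ {p q} → TriangleCycleEdge p q → SymClosure ClosedUnitEdge (to p) (to q)
  to-edge (cycle 0F) = fwd (inUnit (path 0F))
  to-edge (cycle 1F) = bwd (inUnit (path 0F))
  to-edge (left 0F)  = fwd (inUnit (left 0F))
  to-edge (left 1F)  = fwd toLast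
  to-edge (right 0F) = fwd (inUnit (right 0F))
  to-edge (right 1F) = fwd toFirst

  from-edge : ∀ {p q} → ClosedUnitEdge p q → SymClosure TriangleCycleEdge (from p) (from q)
  from-edge (inUnit (path 0F))  = fwd (cycle 0F)
  from-edge (inUnit (left 0F))  = fwd (left 0F)
  from-edge (inUnit (right 0F)) = fwd (right 0F)
  from-edge toFirst             = fwd (right 1F)
  from-edge toLast              = fwd (left 1F)

triangleCycle⇒𝒢 : ∀ {V} {G : Graph V} l .{{_ : NonTrivial l}} → 2 ∣ l → 2 ≤ l → G ≅ TriangleCycle l → 𝒢 G
triangleCycle⇒𝒢 (suc zero) _ (s≤s ()) _
triangleCycle⇒𝒢 {G = G} (suc (suc zero)) even _ iso =
  inj₂ (inj₁ (mk 1 ≤-refl even (≅-trans {F = G} {G = TriangleCycle 2} {H = ClosedUnit 1} iso triangleCycle₂≅closedUnit)))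
triangleCycle⇒𝒢 (suc (suc (suc zero))) (divides (suc (suc _)) ()) _ _
triangleCycle⇒𝒢 (suc (suc (suc (suc l)))) even _ iso =
  inj₂ (inj₂ (mk (suc (suc (suc (suc l)))) (s≤s (s≤s (s≤s (s≤s z≤n)))) even iso))

-- The two directions of the characterization.

𝒢⇒half-weight : ∀ {n} {G : Graph (Fin n)} → 𝒢 G → HalfWeight G
𝒢⇒half-weight {G = G} (inj₁ (mk t even iso)) = unitRing-half t even {G = G} iso
𝒢⇒half-weight {G = G} (inj₂ (inj₁ (mk t _ even iso))) =
  unitRing-half {1} (λ _ → t) (subst (2 ∣_) (cong suc (sym (+-identityʳ t))) even) {G = G}
    (≅-trans {F = G} {G = ClosedUnit t} {H = UnitRing {1} (λ _ → t)} iso (closedUnit≅unitRing t))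
𝒢⇒half-weight {G = G} (inj₂ (inj₂ (mk l _ even iso))) = triangleCycle-half l even {G = G} iso

half-weight⇒𝒢 : ∀ {n} (G : Graph (Fin n)) → Decidable (Graph._~_ G) → Connected G → ClawFree G →
                HalfWeight G → 𝒢 G
half-weight⇒𝒢 G _~?_ connected claw-free (f , r , 2w≡n)
  with Cycle.necklace-cases G _~?_ claw-free f r 2w≡n (proj₁ connected)
... | inj₁ (N , linked) = triangleCycle⇒𝒢 {G = G} size 2∣size 1<size
  (FromNecklace.≅TriangleCycle {G = G} connected N linked)
  where
  open Necklace N
  1<size : 1 < size
  1<size = ∣⇒≤ 2∣size
  instance
    size-nonTrivial : NonTrivial size
    size-nonTrivial = n>1⇒nonTrivial 1<size
-- A necklace with a single break gives a ring of one unit, so this case also stays within `𝒢₁`.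
... | inj₂ (N , break) = inj₁ (mk t (subst (2 ∣_) (sym total≡m) 2∣size)
  (FromNecklace.≅UnitRing {G = G} connected N t total≡m ends
    (λ j i i<t → decidable-stable (x _ ~? x _) (interior j i i<t)) zero))
  where
  open Necklace N
  open Segmentation (segment (λ i → ¬? (x i ~? x (suc i))) pre-size break)

theorem1 : (n : ℕ) (G : Graph (Fin n)) (_~?_ : Decidable (Graph._~_ G)) →
    Connected G → ClawFree G →
    (n ≤ 2 * γoir2 G _~?_) × ((2 * γoir2 G _~?_ ≡ n) ⇔ 𝒢 G)
theorem1 n G _~?_ connected claw-free with γoir2 G _~?_ | γoir2-isMin G _~?_
... | γ | record { attained = f , r , refl ; minimal = minimal } = lower , mk⇔
  (λ 2γ≡n → half-weight⇒𝒢 G _~?_ connected claw-free (f , r , 2γ≡n))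
  -- Minimality against a function of weight n/2 gives the upper bound that meets `lower`.
  (λ G∈𝒢 → let g , s , 2w≡n = 𝒢⇒half-weight {G = G} G∈𝒢
            in  ≤-antisym (≤-trans (*-monoʳ-≤ 2 (minimal g s)) (≤-reflexive 2w≡n)) lower)
  where
  lower : n ≤ 2 * weight f
  lower = DoubleCounting.n≤2weight G _~?_ claw-free f r
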